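{- Let $n$ be a positive integer with $n\equiv 4,12,20,28,44$ or $52 \pmod{56}$. Then there exists a configuration $(2,4)$ $GDD\left(n,2,6;\frac{7n}{4},2(n-1)\right)$.
   Context: A $GDD(n,2,6;\lambda_1,\lambda_2)$ is a finite collection (repetitions allowed) of $6$-element subsets, called blocks, of a $2n$-element set $X$ partitioned into two groups of size $n$, such that every point lies in the same number $r$ of blocks, any two distinct points of the same group lie together in exactly $\lambda_1$ blocks, and any two points from different groups lie together in exactly $\lambda_2$ blocks. It has configuration $(2,4)$ if every block has exactly $2$ points in one of the two groups and $4$ points in the other (which group contains the $2$ points may depend on the block). -}

module Defs where

open import Data.Fin using (Fin)
open import Data.Fin.Patterns using (0F; 1F)
open import Data.Fin.Subset using (Subset; _∈_; _∩_; ∣_∣)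
open import Data.Fin.Subset.Properties using (_∈?_)
open import Data.List using (List; length; filter)
open import Data.List.Relation.Unary.All using (All)
open import Data.Nat using (ℕ; _*_)
open import Data.Product using (∃; ∃!; _×_)
open import Data.Sum using (_⊎_)
open import Relation.Binary.PropositionalEquality using (_≡_; _≢_)
open import Relation.Nullary.Decidable using (_×-dec_)

-- Occurrences are counted with multiplicity.
replication : ∀ {v} → List (Subset v) → Fin v → ℕ
replication blocks x = length (filter (x ∈?_) blocks)

coverage : ∀ {v} → List (Subset v) → Fin v → Fin v → ℕ
coverage blocks x y = length (filter (λ B → (x ∈? B) ×-dec (y ∈? B)) blocks)

-- GDD(n, m, k; λ₁, λ₂): m groups of size n, blocks of size k.  The list of
-- blocks stands for a multiset.
record GDD (n m k λ₁ λ₂ : ℕ) : Set where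
  field
    group  : Fin m → Subset (m * n)
    blocks : List (Subset (m * n))

    groups-partition : ∀ x → ∃! _≡_ (λ g → x ∈ group g)
    group-size       : ∀ g → ∣ group g ∣ ≡ n
    block-size       : All (λ B → ∣ B ∣ ≡ k) blocks

    equireplicate : ∃ λ r → ∀ x → replication blocks x ≡ r

    same-group : ∀ g {x y} → x ∈ group g → y ∈ group g → x ≢ y →
                 coverage blocks x y ≡ λ₁
    diff-group : ∀ {g h} → g ≢ h → ∀ {x y} → x ∈ group g → y ∈ group h →
                 coverage blocks x y ≡ λ₂

-- Which of the two groups contains the s points may depend on the block.
HasConfiguration : ∀ {n k λ₁ λ₂} → ℕ → ℕ → GDD n 2 k λ₁ λ₂ → Set
HasConfiguration s t D = All splits blocks
  where
  open GDD D
  splits : Subset _ → Set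
  splits B = (∣ B ∩ group 0F ∣ ≡ s × ∣ B ∩ group 1F ∣ ≡ t)
           ⊎ (∣ B ∩ group 0F ∣ ≡ t × ∣ B ∩ group 1F ∣ ≡ s)

{-# OPTIONS --safe #-}

-- Write n = 4k with k = 2h + 1 odd and take each group to be four levels of
-- ℤ/k.  Choose base blocks (E , Q), with E a pair and Q a 4-set of points on
-- the four levels; the blocks are E + a in one group together with Q + b in
-- the other, for all a, b ∈ ℤ/k and both roles of the groups.  Because the two
-- groups are translated independently, two points of different groups meet in
-- a number of blocks that depends on their levels only, and two points of one
-- group meet in k times the number of occurrences of their difference in the
-- base blocks.  So it suffices that every difference occurs 7 times and that
-- the numbers of points of E and Q on the levels are suitably matched.
--
-- The base blocks come in families of affine functions of d ∈ ℤ/k.  A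
-- difference of slope ±1, ±2 or ±4 takes every value once as d varies, as k is
-- odd.  When 3 ∣ k a difference of slope ±3 does not, but the three functions
-- 3d - 1, 3d, 3d + 1 together take every value three times.

module Submission where

open import Data.Bool using (Bool; true; false; _∧_)
open import Data.Empty using (⊥)
open import Data.Fin using (Fin; toℕ; combine; remQuot; _↑ˡ_; _↑ʳ_)
open import Data.Fin.Patterns
import Data.Fin.Properties as Fin
open import Data.Fin.Subset using (Subset; inside; outside; _∩_; ∣_∣)
  renaming (_∈_ to _∈ˢ_; ⊤ to ⊤ˢ)
open import Data.Fin.Subset.Properties using (_∈?_; ∩-identityˡ)
open import Data.Integer as ℤ using (ℤ; -[1+_]; 0ℤ; 1ℤ; -1ℤ) renaming (+_ to pos)
open import Data.Integer.Divisibility.Signed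
  using (_∣_; divides; _∣?_; ∣m∣n⇒∣m+n; ∣m∣n⇒∣m-n; ∣m+n∣n⇒∣m; ∣-refl; ∣⇒∣ᵤ)
import Data.Integer.Properties as ℤ
import Data.Integer.Tactic.RingSolver as ℤSolver
open import Data.List
  using (List; []; _∷_; _++_; map; concatMap; upTo; allFin; cartesianProduct;
         cartesianProductWith; length; reverse; filter)
open import Data.List.Membership.Propositional using (_∈_)
open import Data.List.Properties
  using (map-upTo; map-cong; map-++; map-∘; map-tabulate; upTo-∷ʳ; length-upTo; length-tabulate)
open import Data.List.Relation.Binary.Permutation.Propositional.Properties
  using (↭-reverse) renaming (map⁺ to map-↭)
open import Data.List.Relation.Unary.All as All using (All; []; _∷_)
open import Data.List.Relation.Unary.All.Properties using (all-upTo; map⁺; ++⁺; concat⁺)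
open import Data.List.Relation.Unary.AllPairs as AllPairs using (AllPairs; []; _∷_; allPairs?)
open import Data.List.Relation.Unary.Any using (here; there)
open import Data.Maybe using (Maybe; just; nothing)
open import Data.Nat
  using (ℕ; zero; suc; _+_; _*_; _∸_; _⊔_; _≤_; _<_; _<ᵇ_; _≟_; z≤n; s≤s)
open import Data.Nat.Coprimality using (Coprime; coprime-divisor)
import Data.Nat.Divisibility as ℕ
open import Data.Nat.DivMod using (_/_; _%_; m≡m%n+[m/n]*n; m*n/n≡m)
open import Data.Nat.ListAction using (sum)
open import Data.Nat.ListAction.Properties using (sum-++; sum-↭)
open import Data.Nat.Properties hiding (_≟_)
import Data.Nat.Tactic.RingSolver as ℕSolver
open import Data.Product using (∃; _×_; _,_; proj₁; proj₂)
open import Data.Product.Properties using (≡-dec)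
open import Data.Sum using (_⊎_; inj₁; inj₂)
open import Data.Vec using (Vec; []; _∷_; _[_]≔_; lookup; replicate; tabulate; updateAt)
import Data.Vec.Properties as Vec
open import Function using (_∘_; id; mk⇔)
open import Relation.Binary.PropositionalEquality
open import Relation.Nullary using (¬_; Dec; yes; no; does; contradiction)
open import Relation.Nullary.Decidable
  using (¬?; _×-dec_; _⊎-dec_; from-yes; does-⇔; dec-true; dec-false)

open import Defs

open ≡-Reasoning

private variable
  A B C : Set

-- Finite sums

∑ : List A → (A → ℕ) → ℕ
∑ xs f = sum (map f xs)

∑-cong : ∀ (xs : List A) {f g : A → ℕ} → (∀ x → f x ≡ g x) → ∑ xs f ≡ ∑ xs g
∑-cong xs f≗g = cong sum (map-cong f≗g xs)

∑-cong-All : ∀ {xs : List A} {f g : A → ℕ} → All (λ x → f x ≡ g x) xs → ∑ xs f ≡ ∑ xs g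
∑-cong-All []         = refl
∑-cong-All (eq ∷ eqs) = cong₂ _+_ eq (∑-cong-All eqs)

∑-++ : ∀ (xs ys : List A) (f : A → ℕ) → ∑ (xs ++ ys) f ≡ ∑ xs f + ∑ ys f
∑-++ xs ys f = trans (cong sum (map-++ f xs ys)) (sum-++ (map f xs) (map f ys))

∑-map : ∀ (g : A → B) xs (f : B → ℕ) → ∑ (map g xs) f ≡ ∑ xs (f ∘ g)
∑-map g xs f = cong sum (sym (map-∘ xs))

∑-concatMap : ∀ (g : A → List B) xs (f : B → ℕ) →
              ∑ (concatMap g xs) f ≡ ∑ xs (λ x → ∑ (g x) f)
∑-concatMap g []       f = refl
∑-concatMap g (x ∷ xs) f =
  trans (∑-++ (g x) (concatMap g xs) f) (cong (∑ (g x) f +_) (∑-concatMap g xs f))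

∑-cartesianProductWith : ∀ (g : A → B → C) xs ys (f : C → ℕ) →
                         ∑ (cartesianProductWith g xs ys) f ≡ ∑ xs (λ x → ∑ ys (λ y → f (g x y)))
∑-cartesianProductWith g []       ys f = refl
∑-cartesianProductWith g (x ∷ xs) ys f =
  trans (∑-++ (map (g x) ys) _ f)
        (cong₂ _+_ (∑-map (g x) ys f) (∑-cartesianProductWith g xs ys f))

∑-+ : ∀ (xs : List A) (f g : A → ℕ) → ∑ xs (λ x → f x + g x) ≡ ∑ xs f + ∑ xs g
∑-+ []       f g = refl
∑-+ (x ∷ xs) f g = trans (cong (f x + g x +_) (∑-+ xs f g)) (swap (f x) (g x) _ _)
  where
  swap : ∀ a b c d → a + b + (c + d) ≡ a + c + (b + d)
  swap = ℕSolver.solve-∀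

∑-*ˡ : ∀ (xs : List A) c (f : A → ℕ) → ∑ xs (λ x → c * f x) ≡ c * ∑ xs f
∑-*ˡ []       c f = sym (*-zeroʳ c)
∑-*ˡ (x ∷ xs) c f = trans (cong (c * f x +_) (∑-*ˡ xs c f)) (sym (*-distribˡ-+ c (f x) _))

∑-*ʳ : ∀ (xs : List A) c (f : A → ℕ) → ∑ xs (λ x → f x * c) ≡ ∑ xs f * c
∑-*ʳ xs c f = trans (∑-cong xs (λ x → *-comm (f x) c)) (trans (∑-*ˡ xs c f) (*-comm c _))

∑-const : ∀ (xs : List A) c → ∑ xs (λ _ → c) ≡ length xs * c
∑-const []       c = refl
∑-const (x ∷ xs) c = cong (c +_) (∑-const xs c)

∑-swap : ∀ (xs : List A) (ys : List B) (f : A → B → ℕ) →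
         ∑ xs (λ x → ∑ ys (f x)) ≡ ∑ ys (λ y → ∑ xs (λ x → f x y))
∑-swap []       ys f = sym (trans (∑-const ys 0) (*-zeroʳ (length ys)))
∑-swap (x ∷ xs) ys f =
  trans (cong (∑ ys (f x) +_) (∑-swap xs ys f)) (sym (∑-+ ys (f x) _))

∑-product : ∀ (xs : List A) (ys : List B) (f : A → ℕ) (g : B → ℕ) →
            ∑ xs (λ x → ∑ ys (λ y → f x * g y)) ≡ ∑ xs f * ∑ ys g
∑-product xs ys f g =
  trans (∑-cong xs (λ x → ∑-*ˡ ys (f x) g)) (∑-*ʳ xs (∑ ys g) f)

∑-reverse : ∀ (xs : List A) (f : A → ℕ) → ∑ (reverse xs) f ≡ ∑ xs f
∑-reverse xs f = sum-↭ (map-↭ f (↭-reverse xs))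

∑-upTo-suc : ∀ n (f : ℕ → ℕ) → ∑ (upTo (suc n)) f ≡ f 0 + ∑ (upTo n) (f ∘ suc)
∑-upTo-suc n f = trans (cong sum (map-upTo f (suc n)))
  (cong (λ ys → f 0 + sum ys) (sym (map-upTo (f ∘ suc) n)))

∑-upTo-last : ∀ n (f : ℕ → ℕ) → ∑ (upTo (suc n)) f ≡ ∑ (upTo n) f + f n
∑-upTo-last n f = begin
  ∑ (upTo (suc n)) f           ≡⟨ cong (λ xs → ∑ xs f) (upTo-∷ʳ n) ⟨
  ∑ (upTo n ++ n ∷ []) f       ≡⟨ ∑-++ (upTo n) _ f ⟩
  ∑ (upTo n) f + (f n + 0)     ≡⟨ cong (∑ (upTo n) f +_) (+-identityʳ (f n)) ⟩
  ∑ (upTo n) f + f n           ∎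

∑-upTo-+ : ∀ m n (f : ℕ → ℕ) → ∑ (upTo (m + n)) f ≡ ∑ (upTo m) f + ∑ (upTo n) (f ∘ (_+_ m))
∑-upTo-+ zero    n f = refl
∑-upTo-+ (suc m) n f = begin
  ∑ (upTo (suc m + n)) f                                              ≡⟨ ∑-upTo-suc (m + n) f ⟩
  f 0 + ∑ (upTo (m + n)) (f ∘ suc)                                    ≡⟨ cong (f 0 +_) (∑-upTo-+ m n (f ∘ suc)) ⟩
  f 0 + (∑ (upTo m) (f ∘ suc) + ∑ (upTo n) (f ∘ (_+_ (suc m))))       ≡⟨ +-assoc (f 0) _ _ ⟨
  f 0 + ∑ (upTo m) (f ∘ suc) + ∑ (upTo n) (f ∘ (_+_ (suc m)))         ≡⟨ cong (_+ ∑ (upTo n)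
      (f ∘ (_+_ (suc m)))) (∑-upTo-suc m f) ⟨
  ∑ (upTo (suc m)) f + ∑ (upTo n) (f ∘ (_+_ (suc m)))                 ∎

∑-upTo-* : ∀ m n (f : ℕ → ℕ) →
           ∑ (upTo (m * n)) f ≡ ∑ (upTo m) (λ i → ∑ (upTo n) (λ j → f (i * n + j)))
∑-upTo-* zero    n f = refl
∑-upTo-* (suc m) n f = begin
  ∑ (upTo (n + m * n)) f
    ≡⟨ ∑-upTo-+ n (m * n) f ⟩
  ∑ (upTo n) f + ∑ (upTo (m * n)) (f ∘ (_+_ n))
    ≡⟨ cong (∑ (upTo n) f +_) (∑-upTo-* m n (f ∘ (_+_ n))) ⟩
  ∑ (upTo n) f + ∑ (upTo m) (λ i → ∑ (upTo n) (λ j → f (n + (i * n + j))))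
    ≡⟨ cong (∑ (upTo n) f +_) (∑-cong (upTo m) λ i → ∑-cong (upTo n) λ j → cong f (sym (+-assoc n (i * n) j))) ⟩
  ∑ (upTo n) f + ∑ (upTo m) (λ i → ∑ (upTo n) (λ j → f (suc i * n + j)))
    ≡⟨ ∑-upTo-suc m (λ i → ∑ (upTo n) (λ j → f (i * n + j))) ⟨
  ∑ (upTo (suc m)) (λ i → ∑ (upTo n) (λ j → f (i * n + j)))
    ∎

-- Indicators, sums over `Fin`, and counts of points and blocks as sums.

𝟙 : Bool → ℕ
𝟙 true  = 1
𝟙 false = 0

∑-allFin-suc : ∀ n (f : Fin (suc n) → ℕ) → ∑ (allFin (suc n)) f ≡ f 0F + ∑ (allFin n) (f ∘ Fin.suc)
∑-allFin-suc n f = cong (λ ys → f 0F + sum ys)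
  (trans (map-tabulate Fin.suc f) (sym (map-tabulate id (f ∘ Fin.suc))))

∑-allFin-toℕ : ∀ n (f : ℕ → ℕ) → ∑ (allFin n) (f ∘ toℕ) ≡ ∑ (upTo n) f
∑-allFin-toℕ zero    f = refl
∑-allFin-toℕ (suc n) f = begin
  ∑ (allFin (suc n)) (f ∘ toℕ)               ≡⟨ ∑-allFin-suc n (f ∘ toℕ) ⟩
  f 0 + ∑ (allFin n) (f ∘ suc ∘ toℕ)         ≡⟨ cong (f 0 +_) (∑-allFin-toℕ n (f ∘ suc)) ⟩
  f 0 + ∑ (upTo n) (f ∘ suc)                 ≡⟨ ∑-upTo-suc n f ⟨
  ∑ (upTo (suc n)) f                         ∎

∑-allFin-+ : ∀ m n (f : Fin (m + n) → ℕ) →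
             ∑ (allFin (m + n)) f ≡ ∑ (allFin m) (λ i → f (i ↑ˡ n)) + ∑ (allFin n) (λ j → f (m ↑ʳ j))
∑-allFin-+ zero    n f = refl
∑-allFin-+ (suc m) n f = begin
  ∑ (allFin (suc m + n)) f
    ≡⟨ ∑-allFin-suc (m + n) f ⟩
  f 0F + ∑ (allFin (m + n)) (f ∘ Fin.suc)
    ≡⟨ cong (f 0F +_) (∑-allFin-+ m n (f ∘ Fin.suc)) ⟩
  f 0F + (∑ (allFin m) (λ i → f (Fin.suc (i ↑ˡ n))) + ∑ (allFin n) (λ j → f (Fin.suc (m ↑ʳ j))))
    ≡⟨ +-assoc (f 0F) _ _ ⟨
  f 0F + ∑ (allFin m) (λ i → f (Fin.suc (i ↑ˡ n))) + ∑ (allFin n) (λ j → f (Fin.suc (m ↑ʳ j)))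
    ≡⟨ cong (_+ ∑ (allFin n) (λ j → f (Fin.suc (m ↑ʳ j)))) (∑-allFin-suc m (λ i → f (i ↑ˡ n))) ⟨
  ∑ (allFin (suc m)) (λ i → f (i ↑ˡ n)) + ∑ (allFin n) (λ j → f (suc m ↑ʳ j))
    ∎

∑-allFin-* : ∀ m n (f : Fin (m * n) → ℕ) →
             ∑ (allFin (m * n)) f ≡ ∑ (allFin m) (λ i → ∑ (allFin n) (λ j → f (combine i j)))
∑-allFin-* zero    n f = refl
∑-allFin-* (suc m) n f = begin
  ∑ (allFin (n + m * n)) f
    ≡⟨ ∑-allFin-+ n (m * n) f ⟩
  ∑ (allFin n) (λ j → f (j ↑ˡ (m * n))) + ∑ (allFin (m * n)) (λ i → f (n ↑ʳ i))
    ≡⟨ cong (∑ (allFin n) (λ j → f (j ↑ˡ (m * n))) +_) (∑-allFin-* m n (λ i → f (n ↑ʳ i))) ⟩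
  ∑ (allFin n) (λ j → f (j ↑ˡ (m * n))) + ∑ (allFin m) (λ i → ∑ (allFin n) (λ j → f (n ↑ʳ combine i j)))
    ≡⟨ ∑-allFin-suc m (λ i → ∑ (allFin n) (λ j → f (combine i j))) ⟨
  ∑ (allFin (suc m)) (λ i → ∑ (allFin n) (λ j → f (combine i j)))
    ∎

length-filter : ∀ {P : A → Set} (P? : ∀ x → Dec (P x)) xs → length (filter P? xs) ≡ ∑ xs (λ x → 𝟙 (does (P? x)))
length-filter P? []       = refl
length-filter P? (x ∷ xs) with does (P? x)
... | true  = cong suc (length-filter P? xs)
... | false = length-filter P? xs

𝟙-∧ : ∀ b c → 𝟙 (b ∧ c) ≡ 𝟙 b * 𝟙 c
𝟙-∧ true  c = sym (*-identityˡ (𝟙 c))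
𝟙-∧ false c = refl

does-∈? : ∀ {n} (x : Fin n) p → does (x ∈? p) ≡ lookup p x
does-∈? 0F           (inside  ∷ p) = refl
does-∈? 0F           (outside ∷ p) = refl
does-∈? (Fin.suc x) (_ ∷ p)       = does-∈? x p

∣∣-∑ : ∀ {n} (p : Subset n) → ∣ p ∣ ≡ ∑ (allFin n) (λ x → 𝟙 (lookup p x))
∣∣-∑ []                    = refl
∣∣-∑ {suc n} p@(inside  ∷ q) = trans (cong suc (∣∣-∑ q)) (sym (∑-allFin-suc n (λ x → 𝟙 (lookup p x))))
∣∣-∑ {suc n} p@(outside ∷ q) = trans (∣∣-∑ q) (sym (∑-allFin-suc n (λ x → 𝟙 (lookup p x))))

replication-∑ : ∀ {v} (blocks : List (Subset v)) x → replication blocks x ≡ ∑ blocks (λ B → 𝟙 (lookup B x))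
replication-∑ blocks x = trans (length-filter (x ∈?_) blocks) (∑-cong blocks λ B → cong 𝟙 (does-∈? x B))

coverage-∑ : ∀ {v} (blocks : List (Subset v)) x y →
             coverage blocks x y ≡ ∑ blocks (λ B → 𝟙 (lookup B x) * 𝟙 (lookup B y))
coverage-∑ blocks x y = trans (length-filter (λ B → (x ∈? B) ×-dec (y ∈? B)) blocks) (∑-cong blocks λ B →
  trans (𝟙-∧ (does (x ∈? B)) _) (cong₂ _*_ (cong 𝟙 (does-∈? x B)) (cong 𝟙 (does-∈? y B))))

All-cartesianProduct : ∀ {P : A × B → Set} {xs} ys → All (λ x → ∀ y → P (x , y)) xs →
                       All P (cartesianProduct xs ys)
All-cartesianProduct ys []         = []
All-cartesianProduct ys (px ∷ pxs) = ++⁺ (map⁺ (All.universal px ys)) (All-cartesianProduct ys pxs)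

-- Blocks will be supports of multiplicity functions; where a multiplicity is at most 1, membership
-- in the support recovers it.
𝟙-0<ᵇ : ∀ {n} → n ≤ 1 → 𝟙 (0 <ᵇ n) ≡ n
𝟙-0<ᵇ z≤n       = refl
𝟙-0<ᵇ (s≤s z≤n) = refl

-- The distance of two numbers below k is at most their maximum, hence below k, and no positive
-- number below k is a multiple of k.
pos-injective-mod : ∀ {k} (i j : Fin k) → pos k ∣ pos (toℕ j) ℤ.- pos (toℕ i) → i ≡ j
pos-injective-mod {k} i j k∣ with ℤ.∣ pos (toℕ j) ℤ.- pos (toℕ i) ∣ in eq | ∣⇒∣ᵤ k∣
... | zero  | _  = Fin.toℕ-injective (sym (ℤ.+-injective (ℤ.i-j≡0⇒i≡j _ _ (ℤ.∣i∣≡0⇒i≡0 eq))))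
... | suc e | k∣e = contradiction (≤-trans (ℕ.∣⇒≤ k∣e) (≤-trans (≤-reflexive (sym eq)) bound))
    (<⇒≱ (⊔-lub-< (Fin.toℕ<n j) (Fin.toℕ<n i)))
  where
  ⊔-lub-< : ∀ {m n o} → m < o → n < o → m ⊔ n < o
  ⊔-lub-< = ⊔-pres-<m
  bound : ℤ.∣ pos (toℕ j) ℤ.- pos (toℕ i) ∣ ≤ toℕ j ⊔ toℕ i
  bound = subst (λ z → ℤ.∣ z ∣ ≤ toℕ j ⊔ toℕ i) (sym (ℤ.m-n≡m⊖n (toℕ j) (toℕ i))) (ℤ.∣m⊝n∣≤m⊔n (toℕ j) (toℕ i))

-- Sums over ℤ/k

module Cyclic (h : ℕ) where

  -- Oddness is built into the form of `k`; being a successor, it also lets `4 * k ∸ 1` compute.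
  k : ℕ
  k = suc (2 * h)

  k≡ : pos k ≡ 1ℤ ℤ.+ pos 2 ℤ.* pos h
  k≡ = cong (λ z → 1ℤ ℤ.+ z) (ℤ.pos-* 2 h)

  -- A function on ℤ/k is taken to be a k-periodic function on ℤ, so that arguments are rewritten by
  -- the ring solver and reduction modulo k happens only inside sums.
  Periodic : (ℤ → ℕ) → Set
  Periodic f = ∀ m → f (m ℤ.+ pos k) ≡ f m

  S : (ℤ → ℕ) → ℕ
  S f = ∑ (upTo k) (λ i → f (pos i))

  S-cong : ∀ {f g} → (∀ m → f m ≡ g m) → S f ≡ S g
  S-cong f≗g = ∑-cong (upTo k) (λ i → f≗g (pos i))

  periodic-* : ∀ {f} → Periodic f → ∀ n m → f (m ℤ.+ pos n ℤ.* pos k) ≡ f m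
  periodic-* {f} per zero    m = cong f (ℤ.+-identityʳ m)
  periodic-* {f} per (suc n) m = begin
    f (m ℤ.+ pos (suc n) ℤ.* pos k)            ≡⟨ cong f (step m (pos n) (pos k)) ⟩
    f (m ℤ.+ pos n ℤ.* pos k ℤ.+ pos k)        ≡⟨ per _ ⟩
    f (m ℤ.+ pos n ℤ.* pos k)                ≡⟨ periodic-* per n m ⟩
    f m                                  ∎
    where
    step : ∀ m n k → m ℤ.+ (1ℤ ℤ.+ n) ℤ.* k ≡ m ℤ.+ n ℤ.* k ℤ.+ k
    step = ℤSolver.solve-∀

  periodic-*ℤ : ∀ {f} → Periodic f → ∀ q m → f (m ℤ.+ q ℤ.* pos k) ≡ f m
  periodic-*ℤ     per (pos n)     m = periodic-* per n m
  periodic-*ℤ {f} per -[1+ n ]  m = begin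
    f (m ℤ.+ -[1+ n ] ℤ.* pos k)                           ≡⟨ periodic-* per (suc n) _ ⟨
    f (m ℤ.+ -[1+ n ] ℤ.* pos k ℤ.+ pos (suc n) ℤ.* pos k)       ≡⟨ cong f (cancel m (pos (suc n)) (pos k)) ⟩
    f m                                                  ∎
    where
    cancel : ∀ m n k → m ℤ.+ (ℤ.- n) ℤ.* k ℤ.+ n ℤ.* k ≡ m
    cancel = ℤSolver.solve-∀

  affine-periodic : ∀ {f} → Periodic f → ∀ s c → Periodic (λ d → f (s ℤ.* d ℤ.+ c))
  affine-periodic {f} per s c m = trans (cong f (move s c m (pos k))) (periodic-*ℤ per s _)
    where
    move : ∀ s c m k → s ℤ.* (m ℤ.+ k) ℤ.+ c ≡ s ℤ.* m ℤ.+ c ℤ.+ s ℤ.* k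
    move = ℤSolver.solve-∀

  -- With f 0 added, the left side is the sum over 0, ..., k, and its last term f k equals f 0 by
  -- periodicity.
  S-suc : ∀ {f} → Periodic f → S (λ m → f (1ℤ ℤ.+ m)) ≡ S f
  S-suc {f} per = +-cancelˡ-≡ (f 0ℤ) _ _ (begin
    f 0ℤ + S (λ m → f (1ℤ ℤ.+ m))          ≡⟨ ∑-upTo-suc k (f ∘ pos) ⟨
    ∑ (upTo (suc k)) (f ∘ pos)              ≡⟨ ∑-upTo-last k (f ∘ pos) ⟩
    S f + f (pos k)                          ≡⟨ cong (S f +_) (per 0ℤ) ⟩
    S f + f 0ℤ                             ≡⟨ +-comm (S f) _ ⟩
    f 0ℤ + S f                             ∎)

  shift-periodic : ∀ {f} → Periodic f → ∀ c → Periodic (λ m → f (c ℤ.+ m))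
  shift-periodic {f} per c m = trans (cong f (sym (ℤ.+-assoc c m (pos k)))) (per _)

  S-shift⁺ : ∀ {f} → Periodic f → ∀ n → S (λ m → f (pos n ℤ.+ m)) ≡ S f
  S-shift⁺ {f} per zero    = S-cong (λ m → cong f (ℤ.+-identityˡ m))
  S-shift⁺ {f} per (suc n) = begin
    S (λ m → f (pos (suc n) ℤ.+ m))            ≡⟨ S-cong (λ m → cong f (assoc (pos n) m)) ⟩
    S (λ m → f (pos n ℤ.+ (1ℤ ℤ.+ m)))       ≡⟨ S-suc (shift-periodic per (pos n)) ⟩
    S (λ m → f (pos n ℤ.+ m))                ≡⟨ S-shift⁺ per n ⟩
    S f                                    ∎
    where
    assoc : ∀ n m → (1ℤ ℤ.+ n) ℤ.+ m ≡ n ℤ.+ (1ℤ ℤ.+ m)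
    assoc = ℤSolver.solve-∀

  S-shift : ∀ {f} → Periodic f → ∀ c → S (λ m → f (c ℤ.+ m)) ≡ S f
  S-shift     per (pos n)    = S-shift⁺ per n
  S-shift {f} per -[1+ n ] = begin
    S (λ m → f (-[1+ n ] ℤ.+ m))                        ≡⟨ S-shift⁺ (shift-periodic per -[1+ n ]) (suc n) ⟨
    S (λ m → f (-[1+ n ] ℤ.+ (pos (suc n) ℤ.+ m)))          ≡⟨ S-cong (λ m → cong f (cancel (pos (suc n)) m)) ⟩
    S f                                                 ∎
    where
    cancel : ∀ n m → (ℤ.- n) ℤ.+ (n ℤ.+ m) ≡ m
    cancel = ℤSolver.solve-∀

  -- The arguments 0, -1, ..., 1 - n are listed in increasing order instead. Periodicity enters only
  -- in `S-reflect`, through the shift by 1 - k.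
  ∑-reflect : ∀ (f : ℤ → ℕ) n →
              ∑ (upTo n) (λ i → f (ℤ.- pos i)) ≡ ∑ (upTo n) (λ i → f (1ℤ ℤ.- pos n ℤ.+ pos i))
  ∑-reflect f zero    = refl
  ∑-reflect f (suc n) = begin
    ∑ (upTo (suc n)) (λ i → f (ℤ.- pos i))
      ≡⟨ ∑-upTo-last n _ ⟩
    ∑ (upTo n) (λ i → f (ℤ.- pos i)) + f (ℤ.- pos n)
      ≡⟨ cong₂ _+_ (∑-reflect f n) (cong f (base (pos n))) ⟩
    ∑ (upTo n) (λ i → f (1ℤ ℤ.- pos n ℤ.+ pos i)) + f (1ℤ ℤ.- pos (suc n) ℤ.+ 0ℤ)
      ≡⟨ +-comm _ (f (1ℤ ℤ.- pos (suc n) ℤ.+ 0ℤ)) ⟩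
    f (1ℤ ℤ.- pos (suc n) ℤ.+ 0ℤ) + ∑ (upTo n) (λ i → f (1ℤ ℤ.- pos n ℤ.+ pos i))
      ≡⟨ cong (f (1ℤ ℤ.- pos (suc n) ℤ.+ 0ℤ) +_) (∑-cong (upTo n) λ i → cong f (step (pos n) (pos i))) ⟩
    f (1ℤ ℤ.- pos (suc n) ℤ.+ 0ℤ) + ∑ (upTo n) (λ i → f (1ℤ ℤ.- pos (suc n) ℤ.+ pos (suc i)))
      ≡⟨ ∑-upTo-suc n (λ i → f (1ℤ ℤ.- pos (suc n) ℤ.+ pos i)) ⟨
    ∑ (upTo (suc n)) (λ i → f (1ℤ ℤ.- pos (suc n) ℤ.+ pos i))
      ∎
    where
    base : ∀ n → ℤ.- n ≡ 1ℤ ℤ.- (1ℤ ℤ.+ n) ℤ.+ 0ℤ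
    base = ℤSolver.solve-∀
    step : ∀ n i → 1ℤ ℤ.- n ℤ.+ i ≡ 1ℤ ℤ.- (1ℤ ℤ.+ n) ℤ.+ (1ℤ ℤ.+ i)
    step = ℤSolver.solve-∀

  S-reflect : ∀ {f} → Periodic f → S (λ m → f (ℤ.- m)) ≡ S f
  S-reflect {f} per = trans (∑-reflect f k) (S-shift per (1ℤ ℤ.- pos k))

  -- For j < c and m < k the number c m + j runs once through 0, ..., c k - 1, which is c complete
  -- residue systems. Here c may share factors with k.
  S-multiples : ∀ {f} → Periodic f → ∀ c →
                ∑ (upTo c) (λ j → S (λ m → f (pos c ℤ.* m ℤ.+ pos j))) ≡ c * S f
  S-multiples {f} per c = begin
    ∑ (upTo c) (λ j → S (λ m → f (pos c ℤ.* m ℤ.+ pos j)))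
      ≡⟨ ∑-swap (upTo c) (upTo k) (λ j i → f (pos c ℤ.* pos i ℤ.+ pos j)) ⟩
    ∑ (upTo k) (λ i → ∑ (upTo c) (λ j → f (pos c ℤ.* pos i ℤ.+ pos j)))
      ≡⟨ (∑-cong (upTo k) λ i → ∑-cong (upTo c) λ j → cong f (lift i c j)) ⟩
    ∑ (upTo k) (λ i → ∑ (upTo c) (λ j → f (pos (i * c + j))))
      ≡⟨ ∑-upTo-* k c (f ∘ pos) ⟨
    ∑ (upTo (k * c)) (f ∘ pos)
      ≡⟨ cong (λ n → ∑ (upTo n) (f ∘ pos)) (*-comm k c) ⟩
    ∑ (upTo (c * k)) (f ∘ pos)
      ≡⟨ ∑-upTo-* c k (f ∘ pos) ⟩
    ∑ (upTo c) (λ i → ∑ (upTo k) (λ j → f (pos (i * k + j))))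
      ≡⟨ (∑-cong (upTo c) λ i → ∑-cong (upTo k) λ j → trans (cong f (lower i j)) (periodic-* per i (pos j))) ⟩
    ∑ (upTo c) (λ _ → S f)
      ≡⟨ ∑-const (upTo c) (S f) ⟩
    length (upTo c) * S f
      ≡⟨ cong (_* S f) (length-upTo c) ⟩
    c * S f
      ∎
    where
    open import Data.List.Properties using (length-upTo)
    lift : ∀ i c j → pos c ℤ.* pos i ℤ.+ pos j ≡ pos (i * c + j)
    lift i c j = trans (cong (λ z → z ℤ.+ pos j) (trans (ℤ.*-comm (pos c) (pos i)) (sym (ℤ.pos-* i c))))
        (sym (ℤ.pos-+ (i * c) j))
    lower : ∀ i j → pos (i * k + j) ≡ pos j ℤ.+ pos i ℤ.* pos k
    lower i j = trans (ℤ.pos-+ (i * k) j) (trans (ℤ.+-comm (pos (i * k)) (pos j))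
        (cong (λ z → pos j ℤ.+ z) (ℤ.pos-* i k)))

  -- `S-multiples` for c = 3 has the remainders 0, 1, 2, and 3 m + 2 = 3 (m + 1) - 1 trades the
  -- remainder 2 for -1.
  S-thirds : ∀ {f} → Periodic f →
             S (λ m → f (pos 3 ℤ.* m ℤ.+ -1ℤ)) + S (λ m → f (pos 3 ℤ.* m ℤ.+ 0ℤ))
             + S (λ m → f (pos 3 ℤ.* m ℤ.+ 1ℤ)) ≡ 3 * S f
  S-thirds {f} per = begin
    x₋ + x₀ + x₊         ≡⟨ rotate x₋ x₀ x₊ ⟩
    x₀ + (x₊ + (x₋ + 0)) ≡⟨ cong (λ x → x₀ + (x₊ + (x + 0))) wrap ⟨
    x₀ + (x₊ + (x₂ + 0)) ≡⟨ S-multiples per 3 ⟩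
    3 * S f              ∎
    where
    x₋ x₀ x₊ x₂ : ℕ
    x₋ = S (λ m → f (pos 3 ℤ.* m ℤ.+ -1ℤ))
    x₀ = S (λ m → f (pos 3 ℤ.* m ℤ.+ 0ℤ))
    x₊ = S (λ m → f (pos 3 ℤ.* m ℤ.+ 1ℤ))
    x₂ = S (λ m → f (pos 3 ℤ.* m ℤ.+ pos 2))
    rotate : ∀ a b c → a + b + c ≡ b + (c + (a + 0))
    rotate = ℕSolver.solve-∀
    next : ∀ m → pos 3 ℤ.* m ℤ.+ pos 2 ≡ pos 3 ℤ.* (1ℤ ℤ.+ m) ℤ.+ -1ℤ
    next = ℤSolver.solve-∀
    wrap : x₂ ≡ x₋
    wrap = trans (S-cong (λ m → cong f (next m))) (S-suc (affine-periodic per (pos 3) -1ℤ))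

  -- 2 m + 1 and 2 (m + h + 1) agree modulo k.
  S-double : ∀ {f} → Periodic f → S (λ m → f (pos 2 ℤ.* m)) ≡ S f
  S-double {f} per = *-cancelˡ-≡ _ _ 2 (begin
    2 * x₀        ≡⟨ cong (λ x → x₀ + (x + 0)) odd ⟨
    x₀ + (x₁ + 0) ≡⟨ cong (_+ (x₁ + 0)) (S-cong λ m → cong f (ℤ.+-identityʳ (pos 2 ℤ.* m))) ⟨
    _             ≡⟨ S-multiples per 2 ⟩
    2 * S f       ∎)
    where
    x₀ x₁ : ℕ
    x₀ = S (λ m → f (pos 2 ℤ.* m))
    x₁ = S (λ m → f (pos 2 ℤ.* m ℤ.+ 1ℤ))
    even-periodic : Periodic (λ m → f (pos 2 ℤ.* m))
    even-periodic m = trans (trans (cong f (sym (ℤ.+-identityʳ _))) (affine-periodic per (pos 2) 0ℤ m))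
        (cong f (ℤ.+-identityʳ _))
    halve : ∀ h m → pos 2 ℤ.* m ℤ.+ 1ℤ ℤ.+ (1ℤ ℤ.+ pos 2 ℤ.* h) ≡ pos 2 ℤ.* (1ℤ ℤ.+ h ℤ.+ m)
    halve = ℤSolver.solve-∀
    odd : x₁ ≡ x₀
    odd = begin
      x₁
        ≡⟨ S-cong (λ m → per (pos 2 ℤ.* m ℤ.+ 1ℤ)) ⟨
      S (λ m → f (pos 2 ℤ.* m ℤ.+ 1ℤ ℤ.+ pos k))
        ≡⟨ S-cong (λ m → cong f (trans (cong (λ z → pos 2 ℤ.* m ℤ.+ 1ℤ ℤ.+ z) k≡) (halve (pos h) m))) ⟩
      S (λ m → f (pos 2 ℤ.* (1ℤ ℤ.+ pos h ℤ.+ m)))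
        ≡⟨ S-shift even-periodic (1ℤ ℤ.+ pos h) ⟩
      x₀
        ∎

  -- 0, 1, …, h, -h, …, -1 is a complete residue system.
  S-symmetric : ∀ {f} → Periodic f →
                S f ≡ f 0ℤ + ∑ (upTo h) (λ i → f (pos (suc i)) + f (ℤ.- pos (suc i)))
  S-symmetric {f} per = begin
    S f
      ≡⟨ ∑-upTo-suc (2 * h) (f ∘ pos) ⟩
    f 0ℤ + ∑ (upTo (h + (h + 0))) (f ∘ pos ∘ suc)
      ≡⟨ cong (λ n → f 0ℤ + ∑ (upTo (h + n)) (f ∘ pos ∘ suc)) (+-identityʳ h) ⟩
    f 0ℤ + ∑ (upTo (h + h)) (f ∘ pos ∘ suc)
      ≡⟨ cong (f 0ℤ +_) (∑-upTo-+ h h (f ∘ pos ∘ suc)) ⟩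
    f 0ℤ + (∑ (upTo h) (f ∘ pos ∘ suc) + ∑ (upTo h) (λ i → f (pos (suc (h + i)))))
      ≡⟨ cong (λ x → f 0ℤ + (∑ (upTo h) (f ∘ pos ∘ suc) + x)) upper ⟩
    f 0ℤ + (∑ (upTo h) (f ∘ pos ∘ suc) + ∑ (upTo h) (λ i → f (ℤ.- pos (suc i))))
      ≡⟨ cong (f 0ℤ +_) (∑-+ (upTo h) (f ∘ pos ∘ suc) _) ⟨
    f 0ℤ + ∑ (upTo h) (λ i → f (pos (suc i)) + f (ℤ.- pos (suc i)))
      ∎
    where
    wrap : ∀ h i → 1ℤ ℤ.+ (h ℤ.+ i) ≡ 1ℤ ℤ.- h ℤ.+ i ℤ.+ -1ℤ ℤ.+ (1ℤ ℤ.+ pos 2 ℤ.* h)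
    wrap = ℤSolver.solve-∀
    negate : ∀ i → ℤ.- i ℤ.+ -1ℤ ≡ ℤ.- (1ℤ ℤ.+ i)
    negate = ℤSolver.solve-∀
    upper : ∑ (upTo h) (λ i → f (pos (suc (h + i)))) ≡ ∑ (upTo h) (λ i → f (ℤ.- pos (suc i)))
    upper = begin
      ∑ (upTo h) (λ i → f (pos (suc (h + i))))
        ≡⟨ (∑-cong (upTo h) λ i → trans (cong f (trans (wrap (pos h) (pos i))
            (cong (λ z → 1ℤ ℤ.- pos h ℤ.+ pos i ℤ.+ -1ℤ ℤ.+ z) (sym k≡)))) (per _)) ⟩
      ∑ (upTo h) (λ i → f (1ℤ ℤ.- pos h ℤ.+ pos i ℤ.+ -1ℤ))
        ≡⟨ ∑-reflect (λ m → f (m ℤ.+ -1ℤ)) h ⟨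
      ∑ (upTo h) (λ i → f (ℤ.- pos i ℤ.+ -1ℤ))
        ≡⟨ ∑-cong (upTo h) (λ i → cong f (negate (pos i))) ⟩
      ∑ (upTo h) (λ i → f (ℤ.- pos (suc i)))
        ∎

  opaque
    -- The indicator of the residue class 0. It is opaque so that the divisibility test never
    -- unfolds during type checking; the lemmas of this block are the only access to it.
    δ : ℤ → ℕ
    δ m = 𝟙 (does (pos k ∣? m))

    δ-∣ : ∀ {m} → pos k ∣ m → δ m ≡ 1
    δ-∣ {m} k∣m = cong 𝟙 (dec-true (pos k ∣? m) k∣m)

    δ-∤ : ∀ {m} → ¬ pos k ∣ m → δ m ≡ 0
    δ-∤ {m} k∤m = cong 𝟙 (dec-false (pos k ∣? m) k∤m)

    δ-⇔ : ∀ {m n} → (pos k ∣ m → pos k ∣ n) → (pos k ∣ n → pos k ∣ m) → δ m ≡ δ n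
    δ-⇔ {m} {n} f g = cong 𝟙 (does-⇔ (mk⇔ f g) (pos k ∣? m) (pos k ∣? n))

  δ-periodic : Periodic δ
  δ-periodic m = δ-⇔ (λ k∣ → ∣m+n∣n⇒∣m k∣ ∣-refl) (λ k∣ → ∣m∣n⇒∣m+n k∣ ∣-refl)

  -- Among 0, ..., 2 h only 0 is a multiple of k = 2 h + 1.
  S-δ : S δ ≡ 1
  S-δ = begin
    S δ                                            ≡⟨ ∑-upTo-suc (2 * h) (δ ∘ pos) ⟩
    δ 0ℤ + ∑ (upTo (2 * h)) (δ ∘ pos ∘ suc)        ≡⟨ cong₂ _+_ (δ-∣ (divides 0ℤ refl))
        (∑-cong-All (All.map vanish (all-upTo (2 * h)))) ⟩
    1 + ∑ (upTo (2 * h)) (λ _ → 0)                 ≡⟨ cong (1 +_) (trans (∑-const (upTo (2 * h)) 0)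
        (*-zeroʳ (length (upTo (2 * h))))) ⟩
    1                                              ∎
    where
    vanish : ∀ {i} → i < 2 * h → δ (pos (suc i)) ≡ 0
    vanish {i} i<2h = δ-∤ λ k∣ → ℕ.>⇒∤ (s≤s i<2h) (∣⇒∣ᵤ k∣)

-- Base blocks and their differences

-- (s , c) stands for the function d ↦ s d + c.
Form : Set
Form = ℤ × ℤ

at : ℤ → Form → ℤ
at d (s , c) = s ℤ.* d ℤ.+ c

-- The points on each of the four levels.
Figure : Set
Figure = Vec (List Form) 4

BaseBlock : Set
BaseBlock = Figure × Figure

-- The pair d, - d on one level has the differences ±2 d, and the pair 2 d, - 2 d has ±4 d. As sets
-- both are invariant under d ↦ - d.
±1 ±2 : List Form
±1 = (1ℤ , 0ℤ) ∷ (-1ℤ , 0ℤ) ∷ []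
±2 = (pos 2 , 0ℤ) ∷ (-[1+ 1 ] , 0ℤ) ∷ []

⟨_,_⟩ : ℤ → ℤ → List Form
⟨ s , c ⟩ = (s , c) ∷ []

pure : Fin 4 → Figure
pure v = replicate 4 [] [ v ]≔ ±1

mixed : Fin 4 → Fin 4 → ℤ → Figure
mixed v w c = (replicate 4 [] [ v ]≔ ⟨ 0ℤ , 0ℤ ⟩) [ w ]≔ ⟨ 0ℤ , c ⟩

-- The differences between levels have slope ±1 or ±2, except for ±3 between levels 0 and 3; there
-- the choices c = -1, 0, 1 supply the three functions 3 d - 1, 3 d, 3 d + 1.
transversal : ℤ → Figure
transversal c = ⟨ 0ℤ , 0ℤ ⟩ ∷ ⟨ 1ℤ , 0ℤ ⟩ ∷ ⟨ pos 2 , 0ℤ ⟩ ∷ ⟨ pos 3 , c ⟩ ∷ []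

constants : ℤ → ℤ → ℤ → Figure
constants a b c = ⟨ 0ℤ , 0ℤ ⟩ ∷ ⟨ 0ℤ , a ⟩ ∷ ⟨ 0ℤ , b ⟩ ∷ ⟨ 0ℤ , c ⟩ ∷ []

-- Used for d = 1, …, 2h.
fullFamilies : List BaseBlock
fullFamilies =
  (pure 0F , (±1           ∷ []            ∷ ⟨ 0ℤ , 0ℤ ⟩ ∷ ⟨ pos 3 , 1ℤ ⟩ ∷ [])) ∷
  (pure 0F , ([]           ∷ ±1            ∷ ⟨ 0ℤ , 1ℤ ⟩ ∷ ⟨ pos 3 , 0ℤ ⟩ ∷ [])) ∷
  (pure 1F , (⟨ 0ℤ , -1ℤ ⟩ ∷ ⟨ pos 3 , 0ℤ ⟩  ∷ ±1          ∷ []             ∷ [])) ∷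
  (pure 1F , (⟨ 0ℤ , 0ℤ ⟩  ∷ ⟨ pos 3 , -1ℤ ⟩ ∷ []          ∷ ±1             ∷ [])) ∷
  (pure 3F , transversal -1ℤ) ∷
  (pure 3F , transversal 0ℤ) ∷
  (pure 2F , transversal 1ℤ) ∷ []

-- Used for d = 1, …, h only, being invariant under d ↦ - d.
halfFamilies : List BaseBlock
halfFamilies =
  (pure 2F , (±1 ∷ ±2 ∷ [] ∷ [] ∷ [])) ∷
  (pure 2F , ([] ∷ [] ∷ ±1 ∷ ±2 ∷ [])) ∷ []

-- The first three 4-sets are the transversals at d = 0; the rest makes up for
-- the differences that the other families lose by omitting d = 0.
singleBlocks : List BaseBlock
singleBlocks =
  (mixed 0F 1F 1ℤ , constants 0ℤ 0ℤ -1ℤ) ∷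
  (mixed 2F 3F 0ℤ , constants 0ℤ 0ℤ 0ℤ) ∷
  (mixed 0F 2F 1ℤ , constants 0ℤ 0ℤ 1ℤ) ∷
  (mixed 0F 3F 1ℤ , constants -1ℤ 0ℤ 0ℤ) ∷
  (mixed 1F 2F 0ℤ , constants 0ℤ 0ℤ 1ℤ) ∷
  (mixed 1F 3F 0ℤ , constants 0ℤ 1ℤ 0ℤ) ∷ []

difference : Form → Form → Form
difference (s , c) (s′ , c′) = s′ ℤ.- s , c′ ℤ.- c

figureDifferences : Fin 4 → Fin 4 → Figure → List Form
figureDifferences v w P = cartesianProductWith difference (lookup P v) (lookup P w)

blockDifferences : Fin 4 → Fin 4 → BaseBlock → List Form
blockDifferences v w (E , Q) = figureDifferences v w E ++ figureDifferences v w Q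

differences : Fin 4 → Fin 4 → List BaseBlock → List Form
differences v w = concatMap (blockDifferences v w)

-- Inside one level the difference 0 of a point with itself is disregarded.
discardZero : Fin 4 → Fin 4 → List Form → List Form
discardZero v w L with v Fin.≟ w
... | yes _ = filter (λ f → ¬? (≡-dec ℤ._≟_ ℤ._≟_ f (0ℤ , 0ℤ))) L
... | no  _ = L

-- Constants -1, 0, 1 (classes 0 to 2), slopes taking each value once (class 3)
-- and the functions ±3 d - 1, ±3 d, ±3 d + 1 (classes 4 to 6).
classifyBy : ℕ → ℤ → Maybe (Fin 7)
classifyBy 0 -[1+ 0 ] = just 0F
classifyBy 0 (pos 0)  = just 1F
classifyBy 0 (pos 1)  = just 2F
classifyBy 1 _        = just 3F
classifyBy 2 _        = just 3F
classifyBy 4 _        = just 3F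
classifyBy 3 -[1+ 0 ] = just 4F
classifyBy 3 (pos 0)  = just 5F
classifyBy 3 (pos 1)  = just 6F
classifyBy _ _        = nothing

classify : Form → Maybe (Fin 7)
classify (s , c) = classifyBy ℤ.∣ s ∣ c

-- A form outside the seven classes makes the result `nothing`, so a result `just t` certifies that
-- every form has been classified.
tally : List Form → Maybe (Vec ℕ 7)
tally []      = just (replicate 7 0)
tally (f ∷ L) with classify f | tally L
... | just i | just t = just (updateAt t i suc)
... | _      | _      = nothing

dot : ∀ {n} → Vec ℕ n → Vec ℕ n → ℕ
dot []       []       = 0
dot (x ∷ xs) (y ∷ ys) = x * y + dot xs ys

dot-zero : ∀ {n} (ys : Vec ℕ n) → dot (replicate n 0) ys ≡ 0
dot-zero []       = refl
dot-zero (y ∷ ys) = dot-zero ys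

dot-updateAt : ∀ {n} (xs ys : Vec ℕ n) i → dot (updateAt xs i suc) ys ≡ lookup ys i + dot xs ys
dot-updateAt (x ∷ xs) (y ∷ ys) 0F      = +-assoc y (x * y) _
dot-updateAt (x ∷ xs) (y ∷ ys) (Fin.suc i) =
  trans (cong (x * y +_) (dot-updateAt xs ys i)) (exchange (x * y) (lookup ys i) _)
  where
  exchange : ∀ a b c → a + (b + c) ≡ b + (a + c)
  exchange = ℕSolver.solve-∀

-- The value at d = 0, kept as a constant form so that `tally` still applies.
flatten : Form → Form
flatten (_ , c) = 0ℤ , c

negateSlope : Form → Form
negateSlope (s , c) = ℤ.- s , c

-- The families are counted over all d ∈ ℤ/k, where a half family occurs twice;
-- hence everything else is doubled.
doubled : Fin 4 → Fin 4 → List Form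
doubled v w =
  differences v w fullFamilies ++ differences v w fullFamilies ++ differences v w halfFamilies

doubledSingles : Fin 4 → Fin 4 → List Form
doubledSingles v w = differences v w singleBlocks ++ differences v w singleBlocks

-- `slopeTally` says that no constant differences remain and that 3 d - 1, 3 d, 3 d + 1 occur
-- equally often; with `slopeTotal` every value is then taken 14 = 2 · 7 times over d ∈ ℤ/k. The
-- shared `residues` say that the single blocks have exactly the differences of the families at d =
-- 0. `symmetric` expresses invariance of the half families under d ↦ - d.
record Balanced (v w : Fin 4) : Set where
  constructor balanced
  field
    {units thirds} : ℕ
    {residues}     : Vec ℕ 7
    slopeTally : tally (discardZero v w (doubled v w)) ≡
                 just (0 ∷ 0 ∷ 0 ∷ units ∷ thirds ∷ thirds ∷ thirds ∷ [])
    slopeTotal : units + 3 * thirds ≡ 14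
    single     : tally (discardZero v w (map flatten (doubledSingles v w))) ≡ just residues
    missing    : tally (discardZero v w (map flatten (doubled v w))) ≡ just residues
    symmetric  : map negateSlope (differences v w halfFamilies) ≡ reverse (differences v w halfFamilies)

-- The lists consist of explicit integers and do not involve k, so each case is a computation;
-- unification reads `units`, `thirds` and `residues` off the tallies.
balance : ∀ v w → Balanced v w
balance 0F 0F = balanced refl refl refl refl refl
balance 0F 1F = balanced refl refl refl refl refl
balance 0F 2F = balanced refl refl refl refl refl
balance 0F 3F = balanced refl refl refl refl refl
balance 1F 0F = balanced refl refl refl refl refl
balance 1F 1F = balanced refl refl refl refl refl
balance 1F 2F = balanced refl refl refl refl refl
balance 1F 3F = balanced refl refl refl refl refl
balance 2F 0F = balanced refl refl refl refl refl
balance 2F 1F = balanced refl refl refl refl refl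
balance 2F 2F = balanced refl refl refl refl refl
balance 2F 3F = balanced refl refl refl refl refl
balance 3F 0F = balanced refl refl refl refl refl
balance 3F 1F = balanced refl refl refl refl refl
balance 3F 2F = balanced refl refl refl refl refl
balance 3F 3F = balanced refl refl refl refl refl

-- Level degrees, sizes and distinctness of the points of a base block

size : Figure → ℕ
size P = ∑ (allFin 4) (λ v → length (lookup P v))

-- The summands belong to the two roles of the groups: the first point lies in the group of the
-- pair, or in that of the 4-set.
degreeProducts : Fin 4 → Fin 4 → BaseBlock → ℕ
degreeProducts v w (E , Q) =
  length (lookup E v) * length (lookup Q w) + length (lookup Q v) * length (lookup E w)

degrees : Fin 4 → BaseBlock → ℕ
degrees v (E , Q) = length (lookup E v) + length (lookup Q v)

HasSizes : BaseBlock → Set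
HasSizes (E , Q) = size E ≡ 2 × size Q ≡ 4

hasSizes : All HasSizes singleBlocks × All HasSizes fullFamilies × All HasSizes halfFamilies
hasSizes = from-yes (All.all? hs? singleBlocks ×-dec All.all? hs? fullFamilies ×-dec All.all? hs? halfFamilies)
  where
  hs? : ∀ B → Dec (HasSizes B)
  hs? (E , Q) = (size E ≟ 2) ×-dec (size Q ≟ 4)

-- The full families are used for 2 h values of d and the half families for h, so the base blocks
-- have 9 + 24 h points on each level.
degrees-constant : ∀ v → ∑ singleBlocks (degrees v) ≡ 9
  × 2 * ∑ fullFamilies (degrees v) + ∑ halfFamilies (degrees v) ≡ 24
degrees-constant = from-yes (Fin.all? λ v →
  (∑ singleBlocks (degrees v) ≟ 9) ×-dec (2 * ∑ fullFamilies (degrees v) + ∑ halfFamilies (degrees v) ≟ 24))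

-- Counted in the same way, the total is 6 + 16 h = 2 (4 k - 1), the required λ₂.
degreeProducts-constant : ∀ v w → ∑ singleBlocks (degreeProducts v w) ≡ 6
  × 2 * ∑ fullFamilies (degreeProducts v w) + ∑ halfFamilies (degreeProducts v w) ≡ 16
degreeProducts-constant = from-yes (Fin.all? λ v → Fin.all? λ w → (∑ singleBlocks (degreeProducts v w) ≟ 6)
  ×-dec (2 * ∑ fullFamilies (degreeProducts v w) + ∑ halfFamilies (degreeProducts v w) ≟ 16))

-- Two points s d + c and s′ d + c on one level stay apart if s′ - s is 2 or 4
-- up to sign, as k is odd and does not divide d.
Separated : Form → Form → Set
Separated (s , c) (s′ , c′) = c ≡ c′ × (ℤ.∣ s′ ℤ.- s ∣ ≡ 2 ⊎ ℤ.∣ s′ ℤ.- s ∣ ≡ 4)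

separated? : ∀ f g → Dec (Separated f g)
separated? (s , c) (s′ , c′) = (c ℤ.≟ c′) ×-dec ((ℤ.∣ s′ ℤ.- s ∣ ≟ 2) ⊎-dec (ℤ.∣ s′ ℤ.- s ∣ ≟ 4))

Levelwise : (Form → Form → Set) → BaseBlock → Set
Levelwise R (E , Q) = ∀ v → AllPairs R (lookup E v) × AllPairs R (lookup Q v)

levelwise? : ∀ {R} → (∀ f g → Dec (R f g)) → ∀ B → Dec (Levelwise R B)
levelwise? R? (E , Q) = Fin.all? λ v → allPairs? R? (lookup E v) ×-dec allPairs? R? (lookup Q v)

-- The empty relation forces at most one point of each figure on a level. This is what is needed at
-- d = 0, where forms with equal constants coincide.
single-separated : All (Levelwise (λ _ _ → ⊥)) singleBlocks
single-separated = from-yes (All.all? (levelwise? λ _ _ → no id) singleBlocks)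

full-separated : All (Levelwise Separated) fullFamilies
full-separated = from-yes (All.all? (levelwise? separated?) fullFamilies)

half-separated : All (Levelwise Separated) halfFamilies
half-separated = from-yes (All.all? (levelwise? separated?) halfFamilies)

-- Weights of forms and the balance of the differences.

module Design (h : ℕ) where
  open Cyclic h

  module _ {F : ℤ → ℕ} (per : Periodic F) where

    -- `F` will be the indicator of a residue e; the weight then counts the d ∈ ℤ/k at which the
    -- form takes the value e.
    weight : Form → ℕ
    weight f = S (λ d → F (at d f))

    -- In the order of the classes of `classifyBy`. The last three stay unevaluated: for 3 ∣ k they
    -- depend on more than `S F`, and only their sum is known.
    weights : Vec ℕ 7
    weights = k * F -1ℤ ∷ k * F 0ℤ ∷ k * F 1ℤ ∷ S F
            ∷ weight (pos 3 , -1ℤ) ∷ weight (pos 3 , 0ℤ) ∷ weight (pos 3 , 1ℤ) ∷ []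

    -- Replacing d by - d permutes ℤ/k and leaves c alone, which justifies that `classify` looks
    -- only at the absolute value of the slope.
    weight-abs : ∀ s c → weight (s , c) ≡ weight (pos ℤ.∣ s ∣ , c)
    weight-abs (pos s)  c = refl
    weight-abs -[1+ s ] c = trans (S-cong λ m → cong F (negate (pos (suc s)) m c))
                                  (S-reflect (affine-periodic per (pos (suc s)) c))
      where
      negate : ∀ s m c → (ℤ.- s) ℤ.* m ℤ.+ c ≡ s ℤ.* (ℤ.- m) ℤ.+ c
      negate = ℤSolver.solve-∀

    weight-0 : ∀ c → weight (0ℤ , c) ≡ k * F c
    weight-0 c = trans (S-cong λ m → cong F (trans (cong (λ z → z ℤ.+ c) (ℤ.*-zeroˡ m)) (ℤ.+-identityˡ c)))
                       (trans (∑-const (upTo k) (F c)) (cong (_* F c) (length-upTo k)))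

    weight-1 : ∀ c → weight (1ℤ , c) ≡ S F
    weight-1 c = trans (S-cong λ m → cong F (swap m c)) (S-shift per c)
      where
      swap : ∀ m c → 1ℤ ℤ.* m ℤ.+ c ≡ c ℤ.+ m
      swap = ℤSolver.solve-∀

    -- Doubling permutes ℤ/k for odd k; slopes 2 and 4 thus reduce to slope 1.
    weight-2s : ∀ s c → weight (pos 2 ℤ.* s , c) ≡ weight (s , c)
    weight-2s s c = trans (S-cong λ m → cong F (double s m c)) (S-double (affine-periodic per s c))
      where
      double : ∀ s m c → pos 2 ℤ.* s ℤ.* m ℤ.+ c ≡ s ℤ.* (pos 2 ℤ.* m) ℤ.+ c
      double = ℤSolver.solve-∀

    classifyBy-sound : ∀ n c {i} → classifyBy n c ≡ just i → weight (pos n , c) ≡ lookup weights i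
    classifyBy-sound 0 -[1+ 0 ] refl = weight-0 -1ℤ
    classifyBy-sound 0 (pos 0)  refl = weight-0 0ℤ
    classifyBy-sound 0 (pos 1)  refl = weight-0 1ℤ
    classifyBy-sound 1 c        refl = weight-1 c
    classifyBy-sound 2 c        refl = trans (weight-2s 1ℤ c) (weight-1 c)
    classifyBy-sound 4 c        refl = trans (weight-2s (pos 2) c) (trans (weight-2s 1ℤ c) (weight-1 c))
    classifyBy-sound 3 -[1+ 0 ] refl = refl
    classifyBy-sound 3 (pos 0)  refl = refl
    classifyBy-sound 3 (pos 1)  refl = refl

    tally-sound : ∀ L {t} → tally L ≡ just t → ∑ L weight ≡ dot t weights
    tally-sound []            refl = sym (dot-zero weights)
    tally-sound ((s , c) ∷ L) eq with classify (s , c) in eqᶠ | tally L in eqᴸ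
    tally-sound ((s , c) ∷ L) refl | just i | just t = begin
      weight (s , c) + ∑ L weight        ≡⟨ cong₂ _+_ (trans (weight-abs s c)
          (classifyBy-sound ℤ.∣ s ∣ c eqᶠ)) (tally-sound L eqᴸ) ⟩
      lookup weights i + dot t weights   ≡⟨ dot-updateAt t weights i ⟨
      dot (updateAt t i suc) weights     ∎

    -- A discarded form is constantly 0 and weighs k · F 0, which vanishes within one level by
    -- hypothesis.
    discardZero-sound : ∀ {v w} → (v ≡ w → F 0ℤ ≡ 0) → ∀ L → ∑ (discardZero v w L) weight ≡ ∑ L weight
    discardZero-sound {v} {w} F0 L with v Fin.≟ w
    ... | no  _   = refl
    ... | yes v≡w = go L
      where
      go : ∀ L → ∑ (filter (λ f → ¬? (≡-dec ℤ._≟_ ℤ._≟_ f (0ℤ , 0ℤ))) L) weight ≡ ∑ L weight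
      go []      = refl
      go (f ∷ L) with ≡-dec ℤ._≟_ ℤ._≟_ f (0ℤ , 0ℤ)
      ... | no  _    = cong (weight f +_) (go L)
      ... | yes refl = trans (go L) (cong (_+ ∑ L weight) (sym (trans (weight-0 0ℤ)
          (trans (cong (k *_) (F0 v≡w)) (*-zeroʳ k)))))

    total : List Form → ℤ → ℕ
    total L d = ∑ L (λ f → F (at d f))

    S-total : ∀ L → S (total L) ≡ ∑ L weight
    S-total L = ∑-swap (upTo k) L (λ i f → F (at (pos i) f))

    total-flatten : ∀ L → ∑ (map flatten L) weight ≡ k * total L 0ℤ
    total-flatten L = begin
      ∑ (map flatten L) weight              ≡⟨ ∑-map flatten L weight ⟩
      ∑ L (weight ∘ flatten)                ≡⟨ ∑-cong L (λ (s , c) → trans (weight-0 c)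
          (cong (λ z → k * F z) (sym (constant s c)))) ⟩
      ∑ L (λ f → k * F (at 0ℤ f))           ≡⟨ ∑-*ˡ L k _ ⟩
      k * total L 0ℤ                        ∎
      where
      constant : ∀ s c → s ℤ.* 0ℤ ℤ.+ c ≡ c
      constant = ℤSolver.solve-∀

    -- After doubling, the sums over 1, ..., 2 h and 1, ..., h become sums over all of ℤ/k without
    -- the terms at d = 0. The full sums amount to 14, and the doubled single blocks restore exactly
    -- the missing terms.
    differences-balanced : ∀ v w → S F ≡ 1 → (v ≡ w → F 0ℤ ≡ 0) →
      total (differences v w singleBlocks) 0ℤ
        + (∑ (upTo (2 * h)) (λ i → total (differences v w fullFamilies) (pos (suc i)))
        +  ∑ (upTo h) (λ i → total (differences v w halfFamilies) (pos (suc i)))) ≡ 7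
    -- Adding the terms at d = 0 to both sides avoids a subtraction in ℕ.
    differences-balanced v w SF≡1 F0 = *-cancelˡ-≡ _ _ 2 (+-cancelˡ-≡ (total D 0ℤ) _ _ (begin
      total D 0ℤ + 2 * (s + (x + y))
        ≡⟨ cong (_+ 2 * (s + (x + y))) (split 0ℤ) ⟩
      2 * f₀ + h₀ + 2 * (s + (x + y))
        ≡⟨ rearrange s x y f₀ h₀ ⟩
      2 * s + (2 * (f₀ + x) + (h₀ + 2 * y))
        ≡⟨ cong₂ _+_ singles (sym slopes) ⟩
      total D 0ℤ + 14
        ∎))
      where
      open Balanced (balance v w)
      Dₛ Dᶠ Dʰ D : List Form
      Dₛ = differences v w singleBlocks
      Dᶠ = differences v w fullFamilies
      Dʰ = differences v w halfFamilies
      D  = doubled v w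
      s x y f₀ h₀ : ℕ
      s  = total Dₛ 0ℤ
      x  = ∑ (upTo (2 * h)) (λ i → total Dᶠ (pos (suc i)))
      y  = ∑ (upTo h) (λ i → total Dʰ (pos (suc i)))
      f₀ = total Dᶠ 0ℤ
      h₀ = total Dʰ 0ℤ
      rearrange : ∀ s x y f₀ h₀ → 2 * f₀ + h₀ + 2 * (s + (x + y)) ≡ 2 * s + (2 * (f₀ + x) + (h₀ + 2 * y))
      rearrange = ℕSolver.solve-∀
      double : ∀ a b → a + (a + b) ≡ 2 * a + b
      double = ℕSolver.solve-∀
      split : ∀ d → total D d ≡ 2 * total Dᶠ d + total Dʰ d
      split d = trans (∑-++ Dᶠ (Dᶠ ++ Dʰ) _) (trans (cong (total Dᶠ d +_) (∑-++ Dᶠ Dʰ _)) (double (total Dᶠ d) _))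
      singles : 2 * s ≡ total D 0ℤ
      -- Both lists have the tally `residues`, hence equal weights; for constant forms these are k
      -- times the totals at d = 0.
      singles = *-cancelˡ-≡ _ _ k (begin
        k * (2 * s)                                            ≡⟨ cong (k *_) (cong (s +_) (+-identityʳ s)) ⟩
        k * (s + s)                                            ≡⟨ cong (k *_) (∑-++ Dₛ Dₛ _) ⟨
        k * total (Dₛ ++ Dₛ) 0ℤ                                ≡⟨ total-flatten (Dₛ ++ Dₛ) ⟨
        ∑ (map flatten (Dₛ ++ Dₛ)) weight                      ≡⟨ discardZero-sound F0 (map flatten (Dₛ ++ Dₛ)) ⟨
        ∑ (discardZero v w (map flatten (Dₛ ++ Dₛ))) weight    ≡⟨ tally-sound (discardZero v w
            (map flatten (Dₛ ++ Dₛ))) single ⟩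
        dot residues weights                                   ≡⟨ tally-sound (discardZero v w
            (map flatten D)) missing ⟨
        ∑ (discardZero v w (map flatten D)) weight             ≡⟨ discardZero-sound F0 (map flatten D) ⟩
        ∑ (map flatten D) weight                               ≡⟨ total-flatten D ⟩
        k * total D 0ℤ                                         ∎)
      even : ∀ d → total Dʰ (ℤ.- d) ≡ total Dʰ d
      even d = begin
        ∑ Dʰ (λ f → F (at (ℤ.- d) f))                       ≡⟨ ∑-cong Dʰ (λ (s , c) → cong F (negate s d c)) ⟩
        ∑ Dʰ (λ (s , c) → F (at d (ℤ.- s , c)))             ≡⟨ ∑-map negateSlope Dʰ (λ f → F (at d f)) ⟨
        ∑ (map negateSlope Dʰ) (λ f → F (at d f)) ≡⟨ cong (λ L → ∑ L (λ f → F (at d f))) symmetric ⟩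
        ∑ (reverse Dʰ) (λ f → F (at d f))                   ≡⟨ ∑-reverse Dʰ _ ⟩
        total Dʰ d                                          ∎
        where
        negate : ∀ s m c → s ℤ.* (ℤ.- m) ℤ.+ c ≡ (ℤ.- s) ℤ.* m ℤ.+ c
        negate = ℤSolver.solve-∀
      total-periodic : ∀ L → Periodic (total L)
      total-periodic L m = ∑-cong L (λ (s , c) → affine-periodic per s c m)
      half-sum : S (total Dʰ) ≡ h₀ + 2 * y
      -- Since d and - d contribute equally, the sum over ℤ/k is the term at 0 plus twice the sum
      -- over 1, ..., h.
      half-sum = begin
        S (total Dʰ)
          ≡⟨ S-symmetric (total-periodic Dʰ) ⟩
        h₀ + ∑ (upTo h) (λ i → total Dʰ (pos (suc i)) + total Dʰ (ℤ.- pos (suc i)))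
          ≡⟨ cong (h₀ +_) (∑-cong (upTo h) λ i → cong (total Dʰ (pos (suc i)) +_)
              (trans (even (pos (suc i))) (sym (+-identityʳ _)))) ⟩
        h₀ + ∑ (upTo h) (λ i → 2 * total Dʰ (pos (suc i)))
          ≡⟨ cong (h₀ +_) (∑-*ˡ (upTo h) 2 _) ⟩
        h₀ + 2 * y
          ∎
      collect : ∀ a b c u t → u * 1 + (t * a + (t * b + (t * c + 0))) ≡ u + t * (a + b + c)
      collect = ℕSolver.solve-∀
      slopes : 14 ≡ 2 * (f₀ + x) + (h₀ + 2 * y)
      slopes = begin
        14
          ≡⟨ slopeTotal ⟨
        units + 3 * thirds
          ≡⟨ cong (units +_) (trans (*-comm 3 thirds) (cong (thirds *_) (sym (trans (S-thirds per)
              (cong (3 *_) SF≡1))))) ⟩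
        units + thirds * (weight (pos 3 , -1ℤ) + weight (pos 3 , 0ℤ) + weight (pos 3 , 1ℤ))
          ≡⟨ collect (weight (pos 3 , -1ℤ)) _ _ units thirds ⟨
        units * 1 + (thirds * weight (pos 3 , -1ℤ) + (thirds * weight (pos 3 , 0ℤ) + (thirds * weight
            (pos 3 , 1ℤ) + 0)))
          ≡⟨ cong (λ σ → units * σ + (thirds * weight (pos 3 , -1ℤ) + (thirds * weight (pos 3 , 0ℤ) +
              (thirds * weight (pos 3 , 1ℤ) + 0)))) SF≡1 ⟨
        dot (0 ∷ 0 ∷ 0 ∷ units ∷ thirds ∷ thirds ∷ thirds ∷ []) weights
          ≡⟨ tally-sound (discardZero v w D) slopeTally ⟨
        ∑ (discardZero v w D) weight
          ≡⟨ discardZero-sound F0 D ⟩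
        ∑ D weight
          ≡⟨ S-total D ⟨
        S (total D)
          ≡⟨ S-cong split ⟩
        S (λ d → 2 * total Dᶠ d + total Dʰ d)
          ≡⟨ ∑-+ (upTo k) (λ i → 2 * total Dᶠ (pos i)) _ ⟩
        S (λ d → 2 * total Dᶠ d) + S (total Dʰ)
          ≡⟨ cong₂ _+_ (trans (∑-*ˡ (upTo k) 2 (total Dᶠ ∘ pos)) (cong (2 *_) (∑-upTo-suc (2 * h)
              (total Dᶠ ∘ pos)))) half-sum ⟩
        2 * (f₀ + x) + (h₀ + 2 * y)
          ∎

  -- A base block together with the value of d.
  Placed : Set
  Placed = BaseBlock × ℤ

  multiples : List BaseBlock → ℕ → List Placed
  multiples Bs n = concatMap (λ i → map (_, pos (suc i)) Bs) (upTo n)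

  -- The index i in `multiples` stands for d = i + 1. At d = 0 the points of `±1` would coincide,
  -- and `singleBlocks` takes the place of the families there.
  base : List Placed
  base = map (_, 0ℤ) singleBlocks ++ multiples fullFamilies (2 * h) ++ multiples halfFamilies h

  ∑-base : ∀ (f : Placed → ℕ) → ∑ base f ≡
    ∑ singleBlocks (λ B → f (B , 0ℤ))
      + (∑ (upTo (2 * h)) (λ i → ∑ fullFamilies (λ B → f (B , pos (suc i))))
      +  ∑ (upTo h) (λ i → ∑ halfFamilies (λ B → f (B , pos (suc i)))))
  ∑-base f = begin
    ∑ base f
      ≡⟨ ∑-++ (map (_, 0ℤ) singleBlocks) (multiples fullFamilies (2 * h) ++ multiples halfFamilies h) f ⟩
    ∑ (map (_, 0ℤ) singleBlocks) f + ∑ (multiples fullFamilies (2 * h) ++ multiples halfFamilies h) f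
      ≡⟨ cong₂ _+_ (∑-map (_, 0ℤ) singleBlocks f) (∑-++ (multiples fullFamilies (2 * h))
          (multiples halfFamilies h) f) ⟩
    ∑ singleBlocks (λ B → f (B , 0ℤ)) + (∑ (multiples fullFamilies (2 * h)) f + ∑ (multiples halfFamilies h) f)
      ≡⟨ cong (∑ singleBlocks (λ B → f (B , 0ℤ)) +_) (cong₂ _+_ (∑-multiples fullFamilies (2 * h))
          (∑-multiples halfFamilies h)) ⟩
    _ ∎
    where
    ∑-multiples : ∀ Bs n → ∑ (multiples Bs n) f ≡ ∑ (upTo n) (λ i → ∑ Bs (λ B → f (B , pos (suc i))))
    ∑-multiples Bs n = trans (∑-concatMap (λ i → map (_, pos (suc i)) Bs) (upTo n) f)
                             (∑-cong (upTo n) λ i → ∑-map (_, pos (suc i)) Bs f)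

  ∑-base-const : ∀ (f : BaseBlock → ℕ) →
    ∑ base (f ∘ proj₁) ≡ ∑ singleBlocks f + h * (2 * ∑ fullFamilies f + ∑ halfFamilies f)
  ∑-base-const f = begin
    ∑ base (f ∘ proj₁)
      ≡⟨ ∑-base (f ∘ proj₁) ⟩
    ∑ singleBlocks f + (∑ (upTo (2 * h)) (λ _ → ∑ fullFamilies f) + ∑ (upTo h) (λ _ → ∑ halfFamilies f))
      ≡⟨ cong (∑ singleBlocks f +_) (cong₂ _+_ (copies (2 * h) _) (copies h _)) ⟩
    ∑ singleBlocks f + (2 * h * ∑ fullFamilies f + h * ∑ halfFamilies f)
      ≡⟨ cong (∑ singleBlocks f +_) (factor h (∑ fullFamilies f) _) ⟩
    ∑ singleBlocks f + h * (2 * ∑ fullFamilies f + ∑ halfFamilies f)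
      ∎
    where
    copies : ∀ n c → ∑ (upTo n) (λ _ → c) ≡ n * c
    copies n c = trans (∑-const (upTo n) c) (cong (_* c) (length-upTo n))
    factor : ∀ h x y → 2 * h * x + h * y ≡ h * (2 * x + y)
    factor = ℕSolver.solve-∀

  All-base : ∀ {P : Placed → Set} → All (λ B → P (B , 0ℤ)) singleBlocks →
             (∀ {i} → i < 2 * h → All (λ B → P (B , pos (suc i))) fullFamilies) →
             (∀ {i} → i < h → All (λ B → P (B , pos (suc i))) halfFamilies) → All P base
  All-base single full half = ++⁺ (map⁺ single) (++⁺
    (concat⁺ (map⁺ (All.map (λ i< → map⁺ (full i<)) (all-upTo (2 * h)))))
    (concat⁺ (map⁺ (All.map (λ i< → map⁺ (half i<)) (all-upTo h)))))

  -- Multiplicities of points in figures and their translates.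

  multiplicity : Figure → ℤ → Fin 4 → ℤ → ℕ
  multiplicity P d v z = ∑ (lookup P v) (λ f → δ (z ℤ.- at d f))

  reflected-δ-periodic : ∀ e → Periodic (λ m → δ (e ℤ.- m))
  reflected-δ-periodic e m = trans (sym (δ-periodic (e ℤ.- (m ℤ.+ pos k)))) (cong δ (cancel e m (pos k)))
    where
    cancel : ∀ e m k → e ℤ.- (m ℤ.+ k) ℤ.+ k ≡ e ℤ.- m
    cancel = ℤSolver.solve-∀

  S-reflected-δ : ∀ e → S (λ m → δ (e ℤ.- m)) ≡ 1
  S-reflected-δ e = trans (S-reflect (shift-periodic δ-periodic e)) (trans (S-shift δ-periodic e) S-δ)

  S-δ-translates : ∀ z p → S (λ a → δ (z ℤ.- a ℤ.- p)) ≡ 1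
  S-δ-translates z p = trans (S-cong λ a → cong δ (swap z a p)) (S-reflected-δ (z ℤ.- p))
    where
    swap : ∀ z a p → z ℤ.- a ℤ.- p ≡ z ℤ.- p ℤ.- a
    swap = ℤSolver.solve-∀

  -- Exactly one translation modulo k carries a given point of level v to z.
  S-multiplicity : ∀ P d v z → S (λ a → multiplicity P d v (z ℤ.- a)) ≡ length (lookup P v)
  S-multiplicity P d v z = begin
    S (λ a → multiplicity P d v (z ℤ.- a))                       ≡⟨ ∑-swap (upTo k) (lookup P v) _ ⟩
    ∑ (lookup P v) (λ f → S (λ a → δ (z ℤ.- a ℤ.- at d f)))      ≡⟨ ∑-cong (lookup P v)
        (λ f → S-δ-translates z (at d f)) ⟩
    ∑ (lookup P v) (λ _ → 1)                                     ≡⟨ trans (∑-const (lookup P v) 1)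
        (*-identityʳ _) ⟩
    length (lookup P v)                                          ∎

  δ-*-δ : ∀ m n → δ m * δ n ≡ δ m * δ (n ℤ.- m)
  δ-*-δ m n with pos k ∣? m
  ... | no  k∤m = trans (cong (_* δ n) (δ-∤ k∤m)) (cong (_* δ (n ℤ.- m)) (sym (δ-∤ k∤m)))
  ... | yes k∣m = cong (δ m *_) (δ-⇔ (λ k∣n → ∣m∣n⇒∣m-n k∣n k∣m)
                    (λ k∣n-m → subst (pos k ∣_) (restore n m) (∣m∣n⇒∣m+n k∣n-m k∣m)))
    where
    restore : ∀ n m → n ℤ.- m ℤ.+ m ≡ n
    restore = ℤSolver.solve-∀

  -- Carrying p to z determines the translation a; it then carries q to y exactly if q - p and y - z
  -- agree modulo k.
  S-δ-*-δ : ∀ z y p q → S (λ a → δ (z ℤ.- a ℤ.- p) * δ (y ℤ.- a ℤ.- q)) ≡ δ (y ℤ.- z ℤ.- (q ℤ.- p))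
  S-δ-*-δ z y p q = begin
    S (λ a → δ (z ℤ.- a ℤ.- p) * δ (y ℤ.- a ℤ.- q))
      ≡⟨ S-cong (λ a → trans (δ-*-δ (z ℤ.- a ℤ.- p) (y ℤ.- a ℤ.- q))
          (cong (λ m → δ (z ℤ.- a ℤ.- p) * δ m) (cancel z y p q a))) ⟩
    S (λ a → δ (z ℤ.- a ℤ.- p) * δ (y ℤ.- z ℤ.- (q ℤ.- p)))
      ≡⟨ ∑-*ʳ (upTo k) (δ (y ℤ.- z ℤ.- (q ℤ.- p))) (λ i → δ (z ℤ.- pos i ℤ.- p)) ⟩
    S (λ a → δ (z ℤ.- a ℤ.- p)) * δ (y ℤ.- z ℤ.- (q ℤ.- p))
      ≡⟨ trans (cong (_* δ (y ℤ.- z ℤ.- (q ℤ.- p))) (S-δ-translates z p)) (*-identityˡ _) ⟩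
    δ (y ℤ.- z ℤ.- (q ℤ.- p))
      ∎
    where
    cancel : ∀ z y p q a → y ℤ.- a ℤ.- q ℤ.- (z ℤ.- a ℤ.- p) ≡ y ℤ.- z ℤ.- (q ℤ.- p)
    cancel = ℤSolver.solve-∀

  -- Summed over pairs of points of the figure, `S-δ-*-δ` turns counting translates through two
  -- points into counting differences.
  S-multiplicities : ∀ P d v w z y →
    S (λ a → multiplicity P d v (z ℤ.- a) * multiplicity P d w (y ℤ.- a)) ≡
    ∑ (figureDifferences v w P) (λ f → δ (y ℤ.- z ℤ.- at d f))
  S-multiplicities P d v w z y = begin
    S (λ a → multiplicity P d v (z ℤ.- a) * multiplicity P d w (y ℤ.- a))
      ≡⟨ S-cong (λ a → ∑-product (lookup P v) (lookup P w) (λ f → δ (z ℤ.- a ℤ.- at d f))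
          (λ g → δ (y ℤ.- a ℤ.- at d g))) ⟨
    S (λ a → ∑ (lookup P v) (λ f → ∑ (lookup P w) (λ g → δ (z ℤ.- a ℤ.- at d f) * δ (y ℤ.- a ℤ.- at d g))))
      ≡⟨ ∑-swap (upTo k) (lookup P v) _ ⟩
    ∑ (lookup P v) (λ f → S (λ a → ∑ (lookup P w) (λ g → δ (z ℤ.- a ℤ.- at d f) * δ (y ℤ.- a ℤ.- at d g))))
      ≡⟨ ∑-cong (lookup P v) (λ f → ∑-swap (upTo k) (lookup P w) _) ⟩
    ∑ (lookup P v) (λ f → ∑ (lookup P w) (λ g → S (λ a → δ (z ℤ.- a ℤ.- at d f) * δ (y ℤ.- a ℤ.- at d g))))
      ≡⟨ (∑-cong (lookup P v) λ f → ∑-cong (lookup P w) λ g → trans (S-δ-*-δ z y (at d f) (at d g))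
          (cong (λ m → δ (y ℤ.- z ℤ.- m)) (linear (proj₁ f) (proj₂ f) (proj₁ g) (proj₂ g) d))) ⟩
    ∑ (lookup P v) (λ f → ∑ (lookup P w) (λ g → δ (y ℤ.- z ℤ.- at d (difference f g))))
      ≡⟨ ∑-cartesianProductWith difference (lookup P v) (lookup P w) _ ⟨
    ∑ (figureDifferences v w P) (λ f → δ (y ℤ.- z ℤ.- at d f))
      ∎
    where
    linear : ∀ s c s′ c′ d → s′ ℤ.* d ℤ.+ c′ ℤ.- (s ℤ.* d ℤ.+ c) ≡ (s′ ℤ.- s) ℤ.* d ℤ.+ (c′ ℤ.- c)
    linear = ℤSolver.solve-∀

  Apart : ℤ → Form → Form → Set
  Apart d f g = ¬ pos k ∣ at d g ℤ.- at d f

  -- Once one point is congruent to z, every later one, being apart from it, is not.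
  multiplicity≤1 : ∀ d z {L} → AllPairs (Apart d) L → ∑ L (λ f → δ (z ℤ.- at d f)) ≤ 1
  multiplicity≤1 d z []                             = z≤n
  multiplicity≤1 d z (_∷_ {x = f} {xs = L} apart aparts) with pos k ∣? z ℤ.- at d f
  ... | no  k∤f = subst (_≤ 1) (cong (_+ ∑ L (λ g → δ (z ℤ.- at d g))) (sym (δ-∤ k∤f))) (multiplicity≤1 d z aparts)
  ... | yes k∣f = ≤-reflexive (cong₂ _+_ (δ-∣ k∣f) (trans (∑-cong-All (All.map (λ {g} → miss {g}) apart))
      (trans (∑-const L 0) (*-zeroʳ (length L)))))
    where
    shift : ∀ z p q → z ℤ.- p ℤ.- (z ℤ.- q) ≡ q ℤ.- p
    shift = ℤSolver.solve-∀
    miss : ∀ {g} → Apart d f g → δ (z ℤ.- at d g) ≡ 0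
    miss {g} ¬k∣ = δ-∤ λ k∣g →
      ¬k∣ (subst (pos k ∣_) (shift z (at d f) (at d g)) (∣m∣n⇒∣m-n k∣f k∣g))

  k-coprime-2 : Coprime k 2
  k-coprime-2 {e} (e∣k , e∣2) = ℕ.∣1⇒≡1 (ℕ.∣m+n∣m⇒∣n (subst (e ℕ.∣_) (+-comm 1 (2 * h)) e∣k)
      (ℕ.∣-trans e∣2 (ℕ.m∣m*n h)))

  k∣2*⇒k∣ : ∀ {n} → k ℕ.∣ 2 * n → k ℕ.∣ n
  k∣2*⇒k∣ = coprime-divisor k-coprime-2

  separated⇒apart : ∀ {i} → i < 2 * h → ∀ {f g} → Separated f g → Apart (pos (suc i)) f g
  separated⇒apart {i} i<2h {s , c} {s′ , .c} (refl , gap) k∣ = ℕ.>⇒∤ (s≤s i<2h) (halve gap)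
    where
    linear : ∀ s s′ c d → s′ ℤ.* d ℤ.+ c ℤ.- (s ℤ.* d ℤ.+ c) ≡ (s′ ℤ.- s) ℤ.* d
    linear = ℤSolver.solve-∀
    k∣gap : k ℕ.∣ ℤ.∣ s′ ℤ.- s ∣ * suc i
    k∣gap = subst (k ℕ.∣_) (trans (cong ℤ.∣_∣ (linear s s′ c (pos (suc i)))) (ℤ.abs-* (s′ ℤ.- s)
        (pos (suc i)))) (∣⇒∣ᵤ k∣)
    halve : ℤ.∣ s′ ℤ.- s ∣ ≡ 2 ⊎ ℤ.∣ s′ ℤ.- s ∣ ≡ 4 → k ℕ.∣ suc i
    halve (inj₁ eq) = k∣2*⇒k∣ (subst (λ n → k ℕ.∣ n * suc i) eq k∣gap)
    halve (inj₂ eq) = k∣2*⇒k∣ (k∣2*⇒k∣ (subst (k ℕ.∣_) (*-assoc 2 2 (suc i))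
        (subst (λ n → k ℕ.∣ n * suc i) eq k∣gap)))

  Simple : Placed → Set
  Simple ((E , Q) , d) = ∀ v z → multiplicity E d v z ≤ 1 × multiplicity Q d v z ≤ 1

  levelwise⇒simple : ∀ {R} d → (∀ {f g} → R f g → Apart d f g) → ∀ B → Levelwise R B → Simple (B , d)
  levelwise⇒simple d R⇒apart B levelwise v z =
    multiplicity≤1 d z (AllPairs.map (λ {f} {g} → R⇒apart {f} {g}) (proj₁ (levelwise v))) ,
    multiplicity≤1 d z (AllPairs.map (λ {f} {g} → R⇒apart {f} {g}) (proj₂ (levelwise v)))

  base-simple : All Simple base
  base-simple = All-base
    (All.map (λ {B} → levelwise⇒simple 0ℤ (λ ()) B) single-separated)
    (λ {i} i< → All.map (λ {B} → levelwise⇒simple (pos (suc i))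
        (λ {f} {g} → separated⇒apart i< {f} {g}) B) full-separated)
    (λ {i} i< → All.map (λ {B} → levelwise⇒simple (pos (suc i)) (λ {f} {g} → separated⇒apart
        (<-≤-trans i< (m≤m+n h (h + 0))) {f} {g}) B) half-separated)

  base-sizes : All (HasSizes ∘ proj₁) base
  base-sizes = let single , full , half = hasSizes in All-base single (λ _ → full) (λ _ → half)

  -- The blocks

  Point : Set
  Point = Fin 2 × Fin 4 × Fin k

  opaque
    -- Opaque together with `decode`, so that the index arithmetic stays hidden behind the two
    -- inverse laws and `∑-points`.
    encode : Point → Fin (2 * (4 * k))
    encode (g , v , i) = combine g (combine v i)

    decode : Fin (2 * (4 * k)) → Point
    decode x = proj₁ (remQuot (4 * k) x) , remQuot k (proj₂ (remQuot {2} (4 * k) x))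

    decode∘encode : ∀ p → decode (encode p) ≡ p
    decode∘encode (g , v , i) = trans
      (cong (λ (g , y) → g , remQuot k y) (Fin.remQuot-combine g (combine v i)))
      (cong (g ,_) (Fin.remQuot-combine v i))

    encode∘decode : ∀ x → encode (decode x) ≡ x
    encode∘decode x = trans
      (cong (combine (proj₁ (remQuot {2} (4 * k) x))) (Fin.combine-remQuot {4} k (proj₂ (remQuot {2} (4 * k) x))))
      (Fin.combine-remQuot {2} (4 * k) x)

    ∑-points : ∀ (f : Point → ℕ) → ∑ (allFin (2 * (4 * k))) (f ∘ decode) ≡
               ∑ (allFin 2) (λ g → ∑ (allFin 4) (λ v → ∑ (allFin k) (λ i → f (g , v , i))))
    ∑-points f = begin
      ∑ (allFin (2 * (4 * k))) (f ∘ decode)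
        ≡⟨ ∑-allFin-* 2 (4 * k) (f ∘ decode) ⟩
      ∑ (allFin 2) (λ g → ∑ (allFin (4 * k)) (λ y → f (decode (combine g y))))
        ≡⟨ ∑-cong (allFin 2) (λ g → ∑-allFin-* 4 k (λ y → f (decode (combine g y)))) ⟩
      ∑ (allFin 2) (λ g → ∑ (allFin 4) (λ v → ∑ (allFin k) (λ i → f (decode (encode (g , v , i))))))
        ≡⟨ (∑-cong (allFin 2) λ g → ∑-cong (allFin 4) λ v → ∑-cong (allFin k) λ i → cong f (decode∘encode
            (g , v , i))) ⟩
      ∑ (allFin 2) (λ g → ∑ (allFin 4) (λ v → ∑ (allFin k) (λ i → f (g , v , i))))
        ∎

  -- The group that receives the pair, and the translations of the pair and of the 4-set.
  Translate : Set
  Translate = Fin 2 × ℕ × ℕ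

  -- A point i lies in the translate by a exactly if i - a lies in the figure. The pair always moves
  -- by `a` and the 4-set by `b`, whichever group receives them.
  incidence : Placed × Translate → Point → ℕ
  incidence (((E , Q) , d) , 0F , a , b) (0F , v , i) = multiplicity E d v (pos (toℕ i) ℤ.- pos a)
  incidence (((E , Q) , d) , 0F , a , b) (1F , v , i) = multiplicity Q d v (pos (toℕ i) ℤ.- pos b)
  incidence (((E , Q) , d) , 1F , a , b) (0F , v , i) = multiplicity Q d v (pos (toℕ i) ℤ.- pos b)
  incidence (((E , Q) , d) , 1F , a , b) (1F , v , i) = multiplicity E d v (pos (toℕ i) ℤ.- pos a)

  translates : List Translate
  translates = cartesianProduct (allFin 2) (cartesianProduct (upTo k) (upTo k))

  indices : List (Placed × Translate)
  indices = cartesianProduct base translates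

  ∑-indices : ∀ (f : Placed × Translate → ℕ) → ∑ indices f ≡
    ∑ base (λ B → ∑ (upTo k) (λ a → ∑ (upTo k) (λ b → f (B , 0F , a , b)))
                + ∑ (upTo k) (λ a → ∑ (upTo k) (λ b → f (B , 1F , a , b))))
  ∑-indices f = trans (∑-cartesianProductWith _,_ base translates f) (∑-cong base λ B → begin
    ∑ translates (λ t → f (B , t))
      ≡⟨ ∑-cartesianProductWith _,_ (allFin 2) (cartesianProduct (upTo k) (upTo k)) (λ t → f (B , t)) ⟩
    ∑ (allFin 2) (λ s → ∑ (cartesianProduct (upTo k) (upTo k)) (λ t → f (B , s , t)))
      ≡⟨ ∑-cong (allFin 2) (λ s → ∑-cartesianProductWith _,_ (upTo k) (upTo k) (λ t → f (B , s , t))) ⟩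
    ∑ (allFin 2) (λ s → ∑ (upTo k) (λ a → ∑ (upTo k) (λ b → f (B , s , a , b))))
      ≡⟨ cong (∑ (upTo k) (λ a → ∑ (upTo k) (λ b → f (B , 0F , a , b))) +_) (+-identityʳ _) ⟩
    ∑ (upTo k) (λ a → ∑ (upTo k) (λ b → f (B , 0F , a , b)))
      + ∑ (upTo k) (λ a → ∑ (upTo k) (λ b → f (B , 1F , a , b)))
      ∎)

  block : Placed × Translate → Subset (2 * (4 * k))
  block t = tabulate (λ x → 0 <ᵇ incidence t (decode x))

  -- No two points of the translated base block collapse, so that membership in the set `block t`
  -- may be replaced by the multiplicity in all counts.
  Faithful : Placed × Translate → Set
  Faithful t = ∀ x → 𝟙 (lookup (block t) x) ≡ incidence t (decode x)

  simple⇒faithful : ∀ {B} → Simple B → ∀ t → Faithful (B , t)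
  simple⇒faithful {B} simple t x =
    trans (cong 𝟙 (Vec.lookup∘tabulate (λ y → 0 <ᵇ incidence (B , t) (decode y)) x)) (𝟙-0<ᵇ (bound t (decode x)))
    where
    bound : ∀ t p → incidence (B , t) p ≤ 1
    bound (0F , a , b) (0F , v , i) = proj₁ (simple v (pos (toℕ i) ℤ.- pos a))
    bound (0F , a , b) (1F , v , i) = proj₂ (simple v (pos (toℕ i) ℤ.- pos b))
    bound (1F , a , b) (0F , v , i) = proj₂ (simple v (pos (toℕ i) ℤ.- pos b))
    bound (1F , a , b) (1F , v , i) = proj₁ (simple v (pos (toℕ i) ℤ.- pos a))

  faithful : All Faithful indices
  faithful = All-cartesianProduct translates (All.map simple⇒faithful base-simple)

  blocks : List (Subset (2 * (4 * k)))
  blocks = map block indices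

  -- Replication numbers and pair counts.

  replication-blocks : ∀ x → replication blocks x ≡ ∑ indices (λ t → incidence t (decode x))
  replication-blocks x = begin
    replication blocks x                           ≡⟨ replication-∑ blocks x ⟩
    ∑ blocks (λ B → 𝟙 (lookup B x))                ≡⟨ ∑-map block indices _ ⟩
    ∑ indices (λ t → 𝟙 (lookup (block t) x))       ≡⟨ ∑-cong-All (All.map (λ faith → faith x) faithful) ⟩
    ∑ indices (λ t → incidence t (decode x))       ∎

  coverage-blocks : ∀ x y → coverage blocks x y ≡ ∑ indices (λ t → incidence t (decode x) * incidence t (decode y))
  coverage-blocks x y = begin
    coverage blocks x y
      ≡⟨ coverage-∑ blocks x y ⟩
    ∑ blocks (λ B → 𝟙 (lookup B x) * 𝟙 (lookup B y))
      ≡⟨ ∑-map block indices _ ⟩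
    ∑ indices (λ t → 𝟙 (lookup (block t) x) * 𝟙 (lookup (block t) y))
      ≡⟨ ∑-cong-All (All.map (λ faith → cong₂ _*_ (faith x) (faith y)) faithful) ⟩
    ∑ indices (λ t → incidence t (decode x) * incidence t (decode y))
      ∎

  -- Points of one group see only one of the two translations; the other is free and contributes the
  -- factor k of r = k (9 + 24 h) and of λ₁ = 7 k.
  ∑-first : ∀ (f : ℕ → ℕ) → ∑ (upTo k) (λ a → ∑ (upTo k) (λ _ → f a)) ≡ k * ∑ (upTo k) f
  ∑-first f = trans (∑-cong (upTo k) λ a → trans (∑-const (upTo k) (f a)) (cong (_* f a) (length-upTo k)))
                    (∑-*ˡ (upTo k) k f)

  ∑-second : ∀ (f : ℕ → ℕ) → ∑ (upTo k) (λ _ → ∑ (upTo k) f) ≡ k * ∑ (upTo k) f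
  ∑-second f = trans (∑-const (upTo k) _) (cong (_* ∑ (upTo k) f) (length-upTo k))

  replication-constant : ∀ p → ∑ indices (λ t → incidence t p) ≡ k * (9 + h * 24)
  replication-constant p = begin
    ∑ indices (λ t → incidence t p)              ≡⟨ ∑-indices (λ t → incidence t p) ⟩
    _                                            ≡⟨ ∑-cong base (λ B → count B p) ⟩
    ∑ base (λ B → k * degrees (proj₁ (proj₂ p)) (proj₁ B))   ≡⟨ ∑-*ˡ base k (degrees (proj₁ (proj₂ p)) ∘ proj₁) ⟩
    k * ∑ base (λ B → degrees (proj₁ (proj₂ p)) (proj₁ B))   ≡⟨ cong (k *_) (degreeSum (proj₁ (proj₂ p))) ⟩
    k * (9 + h * 24)                             ∎
    where
    degreeSum : ∀ v → ∑ base (λ B → degrees v (proj₁ B)) ≡ 9 + h * 24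
    degreeSum v = trans (∑-base-const (degrees v))
      (cong₂ (λ x y → x + h * y) (proj₁ (degrees-constant v)) (proj₂ (degrees-constant v)))
    distrib : ∀ k x y → k * x + k * y ≡ k * (x + y)
    distrib = ℕSolver.solve-∀
    distrib′ : ∀ k x y → k * y + k * x ≡ k * (x + y)
    distrib′ = ℕSolver.solve-∀
    count : ∀ B p → ∑ (upTo k) (λ a → ∑ (upTo k) (λ b → incidence (B , 0F , a , b) p))
                  + ∑ (upTo k) (λ a → ∑ (upTo k) (λ b → incidence (B , 1F , a , b) p))
                  ≡ k * degrees (proj₁ (proj₂ p)) (proj₁ B)
    count ((E , Q) , d) (0F , v , i) = trans
      (cong₂ _+_ (trans (∑-first _) (cong (k *_) (S-multiplicity E d v (pos (toℕ i)))))
                 (trans (∑-second _) (cong (k *_) (S-multiplicity Q d v (pos (toℕ i))))))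
      (distrib k (length (lookup E v)) _)
    count ((E , Q) , d) (1F , v , i) = trans
      (cong₂ _+_ (trans (∑-second _) (cong (k *_) (S-multiplicity Q d v (pos (toℕ i)))))
                 (trans (∑-first _) (cong (k *_) (S-multiplicity E d v (pos (toℕ i))))))
      (distrib′ k (length (lookup E v)) _)

  pairCount : Point → Point → ℕ
  pairCount p q = ∑ indices (λ t → incidence t p * incidence t q)

  -- Of the two roles, one places translates of E in the group and the other translates of Q, so
  -- together all differences of the base block count. `differences-balanced` is applied to the
  -- indicator of e = y - z.
  same-group-count : ∀ g v w i j → (v , i) ≢ (w , j) → pairCount (g , v , i) (g , w , j) ≡ 7 * k
  same-group-count g v w i j vi≢wj = begin
    pairCount (g , v , i) (g , w , j)
      ≡⟨ ∑-indices (λ t → incidence t (g , v , i) * incidence t (g , w , j)) ⟩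
    _
      ≡⟨ ∑-cong base (count g) ⟩
    ∑ base (λ B → k * occurrences (blockDifferences v w (proj₁ B)) (proj₂ B))
      ≡⟨ ∑-*ˡ base k baseOccurrences ⟩
    k * ∑ base (λ B → occurrences (blockDifferences v w (proj₁ B)) (proj₂ B))
      ≡⟨ cong (k *_) (∑-base baseOccurrences) ⟩
    k * _
      ≡⟨ cong (k *_) (cong₂ _+_ (merge singleBlocks 0ℤ) (cong₂ _+_
           (∑-cong (upTo (2 * h)) λ i → merge fullFamilies (pos (suc i)))
           (∑-cong (upTo h) λ i → merge halfFamilies (pos (suc i))))) ⟩
    k * _
      ≡⟨ cong (k *_) (differences-balanced per v w (S-reflected-δ e) nonzero) ⟩
    k * 7
      ≡⟨ *-comm k 7 ⟩
    7 * k
      ∎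
    where
    z y e : ℤ
    z = pos (toℕ i)
    y = pos (toℕ j)
    e = y ℤ.- z
    per : Periodic (λ m → δ (e ℤ.- m))
    per = reflected-δ-periodic e
    occurrences : List Form → ℤ → ℕ
    occurrences L d = ∑ L (λ f → δ (e ℤ.- at d f))
    baseOccurrences : Placed → ℕ
    baseOccurrences (B , d) = occurrences (blockDifferences v w B) d
    merge : ∀ Bs d → ∑ Bs (λ B → occurrences (blockDifferences v w B) d) ≡ occurrences (differences v w Bs) d
    merge Bs d = sym (∑-concatMap (blockDifferences v w) Bs _)
    nonzero : v ≡ w → δ (e ℤ.- 0ℤ) ≡ 0
    -- Distinct points of one level differ by a nonzero residue, so the discarded differences 0 do
    -- not count.
    nonzero refl = δ-∤ λ k∣ → vi≢wj (cong (v ,_) (pos-injective-mod i j (subst (pos k ∣_) (ℤ.+-identityʳ e) k∣)))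
    distrib : ∀ k x y → k * x + k * y ≡ k * (x + y)
    distrib = ℕSolver.solve-∀
    figure : ∀ P d → k * S (λ a → multiplicity P d v (z ℤ.- a) * multiplicity P d w (y ℤ.- a))
                   ≡ k * occurrences (figureDifferences v w P) d
    figure P d = cong (k *_) (S-multiplicities P d v w z y)
    joint : ∀ E Q d → k * occurrences (figureDifferences v w E) d + k * occurrences (figureDifferences v w Q) d
                    ≡ k * occurrences (blockDifferences v w (E , Q)) d
    joint E Q d = trans (distrib k (occurrences (figureDifferences v w E) d) _) (cong (k *_)
        (sym (∑-++ (figureDifferences v w E) _ _)))
    count : ∀ g B →
      ∑ (upTo k) (λ a → ∑ (upTo k) (λ b → incidence (B , 0F , a , b) (g , v , i)
                                     * incidence (B , 0F , a , b) (g , w , j)))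
      + ∑ (upTo k) (λ a → ∑ (upTo k) (λ b → incidence (B , 1F , a , b) (g , v , i)
                                     * incidence (B , 1F , a , b) (g , w , j)))
      ≡ k * occurrences (blockDifferences v w (proj₁ B)) (proj₂ B)
    count 0F ((E , Q) , d) = trans (cong₂ _+_ (trans (∑-first _) (figure E d)) (trans (∑-second _)
        (figure Q d))) (joint E Q d)
    count 1F ((E , Q) , d) = trans (cong₂ _+_ (trans (∑-second _) (figure Q d)) (trans (∑-first _) (figure E d)))
                                   (trans (+-comm (k * occurrences (figureDifferences v w Q) d) _) (joint E Q d))

  -- Each of the two translations affects only one of the points, so the double sum factors into a
  -- product of level degrees, independent of i and j.
  diff-group-count : ∀ g g′ → g ≢ g′ → ∀ v w i j → pairCount (g , v , i) (g′ , w , j) ≡ 2 * (4 * k ∸ 1)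
  diff-group-count g g′ g≢g′ v w i j = begin
    pairCount (g , v , i) (g′ , w , j)
      ≡⟨ ∑-indices (λ t → incidence t (g , v , i) * incidence t (g′ , w , j)) ⟩
    _
      ≡⟨ ∑-cong base (count g g′ g≢g′) ⟩
    ∑ base (λ B → degreeProducts v w (proj₁ B))
      ≡⟨ ∑-base-const (degreeProducts v w) ⟩
    _
      ≡⟨ cong₂ (λ x y → x + h * y) (proj₁ (degreeProducts-constant v w)) (proj₂ (degreeProducts-constant v w)) ⟩
    6 + h * 16
      ≡⟨ evaluate h ⟩
    -- This is what `2 * (4 * k ∸ 1)` computes to, the leading `suc` of k being cancelled by the
    -- truncated subtraction.
    2 * (2 * h + (k + (k + (k + 0))))
      ∎
    where
    z y : ℤ
    z = pos (toℕ i)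
    y = pos (toℕ j)
    evaluate : ∀ h → 6 + h * 16 ≡ 2 * (2 * h + (1 + 2 * h + (1 + 2 * h + (1 + 2 * h + 0))))
    evaluate = ℕSolver.solve-∀
    independent : ∀ P d v z P′ w y →
      ∑ (upTo k) (λ a → ∑ (upTo k) (λ b → multiplicity P d v (z ℤ.- pos a) * multiplicity P′ d w (y ℤ.- pos b)))
      ≡ length (lookup P v) * length (lookup P′ w)
    independent P d v z P′ w y = trans (∑-product (upTo k) (upTo k) (λ a → multiplicity P d v
        (z ℤ.- pos a)) (λ b → multiplicity P′ d w (y ℤ.- pos b)))
      (cong₂ _*_ (S-multiplicity P d v z) (S-multiplicity P′ d w y))
    independent′ : ∀ P d v z P′ w y →
      ∑ (upTo k) (λ a → ∑ (upTo k) (λ b → multiplicity P d v (z ℤ.- pos b) * multiplicity P′ d w (y ℤ.- pos a)))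
      ≡ length (lookup P v) * length (lookup P′ w)
    independent′ P d v z P′ w y = trans (∑-swap (upTo k) (upTo k) (λ a b → multiplicity P d v
        (z ℤ.- pos b) * multiplicity P′ d w (y ℤ.- pos a)))
      (independent P d v z P′ w y)
    count : ∀ g g′ → g ≢ g′ → ∀ B →
      ∑ (upTo k) (λ a → ∑ (upTo k) (λ b → incidence (B , 0F , a , b) (g , v , i)
                                     * incidence (B , 0F , a , b) (g′ , w , j)))
      + ∑ (upTo k) (λ a → ∑ (upTo k) (λ b → incidence (B , 1F , a , b) (g , v , i)
                                     * incidence (B , 1F , a , b) (g′ , w , j)))
      ≡ degreeProducts v w (proj₁ B)
    count 0F 0F 0≢0 _ = contradiction refl 0≢0
    count 1F 1F 1≢1 _ = contradiction refl 1≢1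
    count 0F 1F _ ((E , Q) , d) = cong₂ _+_ (independent E d v z Q w y) (independent′ Q d v z E w y)
    count 1F 0F _ ((E , Q) , d) = trans
      (cong₂ _+_ (independent′ Q d v z E w y) (independent E d v z Q w y))
      (+-comm (length (lookup Q v) * length (lookup E w)) _)

  -- The groups, and the sizes of blocks and groups.

  group : Fin 2 → Subset (2 * (4 * k))
  group g = tabulate (λ x → does (proj₁ (decode x) Fin.≟ g))

  lookup-group : ∀ g x → lookup (group g) x ≡ does (proj₁ (decode x) Fin.≟ g)
  lookup-group g = Vec.lookup∘tabulate (λ x → does (proj₁ (decode x) Fin.≟ g))

  ∈-group⁺ : ∀ {g x} → proj₁ (decode x) ≡ g → x ∈ˢ group g
  ∈-group⁺ {g} {x} eq = Vec.lookup⇒[]= x (group g) (trans (lookup-group g x)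
      (dec-true (proj₁ (decode x) Fin.≟ g) eq))

  ∈-group⁻ : ∀ {g x} → x ∈ˢ group g → proj₁ (decode x) ≡ g
  ∈-group⁻ {g} {x} x∈ with proj₁ (decode x) Fin.≟ g | trans (sym (lookup-group g x)) (Vec.[]=⇒lookup x∈)
  ... | yes eq | _ = eq

  -- The indicator of the group is constant on each of the two summands over g′ and keeps the one
  -- for `g`.
  count-in-group : ∀ (p : Subset (2 * (4 * k))) (f : Point → ℕ) → (∀ x → 𝟙 (lookup p x) ≡ f (decode x)) → ∀ g →
    ∣ p ∩ group g ∣ ≡ ∑ (allFin 4) (λ v → ∑ (allFin k) (λ i → f (g , v , i)))
  count-in-group p f p≗f g = begin
    ∣ p ∩ group g ∣
      ≡⟨ ∣∣-∑ (p ∩ group g) ⟩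
    ∑ (allFin (2 * (4 * k))) (λ x → 𝟙 (lookup (p ∩ group g) x))
      ≡⟨ ∑-cong (allFin (2 * (4 * k))) (λ x → trans (cong 𝟙 (Vec.lookup-zipWith _∧_ x p (group g)))
           (trans (𝟙-∧ (lookup p x) _) (cong₂ _*_ (p≗f x) (cong 𝟙 (lookup-group g x))))) ⟩
    ∑ (allFin (2 * (4 * k))) (λ x → f (decode x) * 𝟙 (does (proj₁ (decode x) Fin.≟ g)))
      ≡⟨ ∑-points (λ q → f q * 𝟙 (does (proj₁ q Fin.≟ g))) ⟩
    ∑ (allFin 2) (λ g′ → ∑ (allFin 4) (λ v → ∑ (allFin k) (λ i → f (g′ , v , i) * 𝟙 (does (g′ Fin.≟ g)))))
      ≡⟨ (∑-cong (allFin 2) λ g′ → trans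
           (∑-cong (allFin 4) λ v → ∑-*ʳ (allFin k) (𝟙 (does (g′ Fin.≟ g))) (λ i → f (g′ , v , i)))
           (∑-*ʳ (allFin 4) (𝟙 (does (g′ Fin.≟ g))) (λ v → ∑ (allFin k) (λ i → f (g′ , v , i))))) ⟩
    ∑ (allFin 2) (λ g′ → inGroup g′ * 𝟙 (does (g′ Fin.≟ g)))
      ≡⟨ select g ⟩
    inGroup g
      ∎
    where
    inGroup : Fin 2 → ℕ
    inGroup g = ∑ (allFin 4) (λ v → ∑ (allFin k) (λ i → f (g , v , i)))
    first : ∀ x y → x * 1 + (y * 0 + 0) ≡ x
    first = ℕSolver.solve-∀
    second : ∀ x y → x * 0 + (y * 1 + 0) ≡ y
    second = ℕSolver.solve-∀
    select : ∀ g → ∑ (allFin 2) (λ g′ → inGroup g′ * 𝟙 (does (g′ Fin.≟ g))) ≡ inGroup g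
    select 0F = first (inGroup 0F) (inGroup 1F)
    select 1F = second (inGroup 0F) (inGroup 1F)

  -- In contrast to `S-multiplicity`, the translation is fixed and the point varies: each form of
  -- the figure is hit by one residue of its level.
  ∑-multiplicity : ∀ P d a → ∑ (allFin 4) (λ v → ∑ (allFin k) (λ i → multiplicity P d v (pos (toℕ i) ℤ.- pos a)))
                 ≡ size P
  ∑-multiplicity P d a = ∑-cong (allFin 4) λ v → begin
    ∑ (allFin k) (λ i → multiplicity P d v (pos (toℕ i) ℤ.- pos a))
      ≡⟨ ∑-allFin-toℕ k (λ i → multiplicity P d v (pos i ℤ.- pos a)) ⟩
    S (λ z → multiplicity P d v (z ℤ.- pos a))
      ≡⟨ ∑-swap (upTo k) (lookup P v) _ ⟩
    ∑ (lookup P v) (λ f → S (λ z → δ (z ℤ.- pos a ℤ.- at d f)))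
      ≡⟨ (∑-cong (lookup P v) λ f → trans (S-cong λ z → cong δ (swap z (pos a) (at d f)))
          (trans (S-shift δ-periodic (ℤ.- pos a ℤ.- at d f)) S-δ)) ⟩
    ∑ (lookup P v) (λ _ → 1)
      ≡⟨ trans (∑-const (lookup P v) 1) (*-identityʳ _) ⟩
    length (lookup P v)
      ∎
    where
    swap : ∀ z a p → z ℤ.- a ℤ.- p ≡ ℤ.- a ℤ.- p ℤ.+ z
    swap = ℤSolver.solve-∀

  ∣p∣-groups : ∀ p → ∣ p ∣ ≡ ∣ p ∩ group 0F ∣ + ∣ p ∩ group 1F ∣
  ∣p∣-groups p = begin
    ∣ p ∣
      ≡⟨ ∣∣-∑ p ⟩
    ∑ (allFin (2 * (4 * k))) (λ x → 𝟙 (lookup p x))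
      ≡⟨ ∑-cong (allFin (2 * (4 * k))) (λ x → cong (𝟙 ∘ lookup p) (sym (encode∘decode x))) ⟩
    ∑ (allFin (2 * (4 * k))) (λ x → f (decode x))
      ≡⟨ ∑-points f ⟩
    ∑ (allFin 2) (λ g → ∑ (allFin 4) (λ v → ∑ (allFin k) (λ i → f (g , v , i))))
      ≡⟨ ∑-cong (allFin 2) (count-in-group p f (λ x → cong (𝟙 ∘ lookup p) (sym (encode∘decode x)))) ⟨
    ∣ p ∩ group 0F ∣ + (∣ p ∩ group 1F ∣ + 0)
      ≡⟨ cong (∣ p ∩ group 0F ∣ +_) (+-identityʳ _) ⟩
    ∣ p ∩ group 0F ∣ + ∣ p ∩ group 1F ∣
      ∎
    where
    f : Point → ℕ
    f q = 𝟙 (lookup p (encode q))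

  Split : Subset (2 * (4 * k)) → Set
  Split B = (∣ B ∩ group 0F ∣ ≡ 2 × ∣ B ∩ group 1F ∣ ≡ 4) ⊎ (∣ B ∩ group 0F ∣ ≡ 4 × ∣ B ∩ group 1F ∣ ≡ 2)

  block-split : ∀ B t → Faithful (B , t) → HasSizes (proj₁ B) → Split (block (B , t))
  block-split B@((E , Q) , d) t@(0F , a , b) faith (∣E∣ , ∣Q∣) = inj₁
    ( trans (count-in-group (block (B , t)) (incidence (B , t)) faith 0F) (trans (∑-multiplicity E d a) ∣E∣)
    , trans (count-in-group (block (B , t)) (incidence (B , t)) faith 1F) (trans (∑-multiplicity Q d b) ∣Q∣))
  block-split B@((E , Q) , d) t@(1F , a , b) faith (∣E∣ , ∣Q∣) = inj₂
    ( trans (count-in-group (block (B , t)) (incidence (B , t)) faith 0F) (trans (∑-multiplicity Q d b) ∣Q∣)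
    , trans (count-in-group (block (B , t)) (incidence (B , t)) faith 1F) (trans (∑-multiplicity E d a) ∣E∣))

  blocks-split : All Split blocks
  blocks-split = map⁺ (All-cartesianProduct translates
    (All.zipWith (λ {B} (simple , sizes) t → block-split B t (simple⇒faithful simple t) sizes)
        (base-simple , base-sizes)))

  split⇒6 : ∀ {B} → Split B → ∣ B ∣ ≡ 6
  split⇒6 {B} (inj₁ (two , four)) = trans (∣p∣-groups B) (cong₂ _+_ two four)
  split⇒6 {B} (inj₂ (four , two)) = trans (∣p∣-groups B) (cong₂ _+_ four two)

  group-size : ∀ g → ∣ group g ∣ ≡ 4 * k
  group-size g = begin
    ∣ group g ∣
      ≡⟨ cong ∣_∣ (∩-identityˡ (group g)) ⟨
    ∣ ⊤ˢ ∩ group g ∣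
      ≡⟨ count-in-group ⊤ˢ (λ _ → 1) (λ x → cong 𝟙 (Vec.lookup-replicate x true)) g ⟩
    ∑ (allFin 4) (λ v → ∑ (allFin k) (λ _ → 1))
      ≡⟨ ∑-cong (allFin 4) (λ v → trans (∑-const (allFin k) 1) (trans (*-identityʳ _)
          (length-tabulate {n = k} id))) ⟩
    ∑ (allFin 4) (λ _ → k)
      ∎

  design : GDD (4 * k) 2 6 (7 * k) (2 * (4 * k ∸ 1))
  design = record
    { group            = group
    ; blocks           = blocks
    ; groups-partition = λ x → proj₁ (decode x) , ∈-group⁺ refl , ∈-group⁻
    ; group-size       = group-size
    ; block-size       = All.map (λ {B} → split⇒6 {B}) blocks-split
    ; equireplicate    = k * (9 + h * 24) , λ x → trans (replication-blocks x) (replication-constant (decode x))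
    ; same-group       = same
    ; diff-group       = diff
    }
    where
    decode-injective : ∀ {x y} → decode x ≡ decode y → x ≡ y
    decode-injective {x} {y} eq = trans (sym (encode∘decode x)) (trans (cong encode eq) (encode∘decode y))
    same-points : ∀ {g} p q → proj₁ p ≡ g → proj₁ q ≡ g → p ≢ q → pairCount p q ≡ 7 * k
    same-points (g , v , i) (_ , w , j) refl refl p≢q = same-group-count g v w i j (p≢q ∘ cong (g ,_))
    diff-points : ∀ {g g′} → g ≢ g′ → ∀ p q → proj₁ p ≡ g → proj₁ q ≡ g′ → pairCount p q ≡ 2 * (4 * k ∸ 1)
    diff-points g≢g′ (g , v , i) (g′ , w , j) refl refl = diff-group-count g g′ g≢g′ v w i j
    same : ∀ g {x y} → x ∈ˢ group g → y ∈ˢ group g → x ≢ y → coverage blocks x y ≡ 7 * k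
    same g {x} {y} x∈ y∈ x≢y = trans (coverage-blocks x y)
      (same-points (decode x) (decode y) (∈-group⁻ x∈) (∈-group⁻ y∈) (x≢y ∘ decode-injective))
    diff : ∀ {g g′} → g ≢ g′ → ∀ {x y} → x ∈ˢ group g → y ∈ˢ group g′ → coverage blocks x y ≡ 2 * (4 * k ∸ 1)
    diff g≢g′ {x} {y} x∈ y∈ = trans (coverage-blocks x y)
      (diff-points g≢g′ (decode x) (decode y) (∈-group⁻ x∈) (∈-group⁻ y∈))

-- Each listed residue is 4 times an odd number 1 + 2 j, and since 56 = 4 · 2 · 7 a full period
-- raises h by 7.
four-odd : ∀ n → n % 56 ∈ (4 ∷ 12 ∷ 20 ∷ 28 ∷ 44 ∷ 52 ∷ []) → ∃ λ h → n ≡ 4 * suc (2 * h)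
four-odd n n%56∈ = let j , eq = odd n%56∈ in j + 7 * (n / 56) , (begin
  n                                           ≡⟨ m≡m%n+[m/n]*n n 56 ⟩
  n % 56 + n / 56 * 56                        ≡⟨ cong (_+ n / 56 * 56) eq ⟩
  4 * (1 + 2 * j) + n / 56 * 56               ≡⟨ collect j (n / 56) ⟩
  4 * (1 + 2 * (j + 7 * (n / 56)))            ∎)
  where
  collect : ∀ j q → 4 * (1 + 2 * j) + q * 56 ≡ 4 * (1 + 2 * (j + 7 * q))
  collect = ℕSolver.solve-∀
  odd : n % 56 ∈ (4 ∷ 12 ∷ 20 ∷ 28 ∷ 44 ∷ 52 ∷ []) → ∃ λ j → n % 56 ≡ 4 * (1 + 2 * j)
  odd (here eq)                                         = 0 , eq
  odd (there (here eq))                                 = 1 , eq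
  odd (there (there (here eq)))                         = 2 , eq
  odd (there (there (there (here eq))))                 = 3 , eq
  odd (there (there (there (there (here eq)))))         = 5 , eq
  odd (there (there (there (there (there (here eq)))))) = 6 , eq

-- The quotient 7 n / 4 is a truncated division in ℕ; it is exact because 4 divides n.
7*4k/4≡7k : ∀ k → 7 * (4 * k) / 4 ≡ 7 * k
7*4k/4≡7k k = trans (cong (_/ 4) (regroup k)) (m*n/n≡m (7 * k) 4)
  where
  regroup : ∀ k → 7 * (4 * k) ≡ 7 * k * 4
  regroup = ℕSolver.solve-∀

corollary5p3 : (n : ℕ) → 0 < n →
    n % 56 ∈ (4 ∷ 12 ∷ 20 ∷ 28 ∷ 44 ∷ 52 ∷ []) →
    ∃ λ (D : GDD n 2 6 ((7 * n) / 4) (2 * (n ∸ 1))) → HasConfiguration 2 4 D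
corollary5p3 n _ n%56∈ =
  let h , n≡4k = four-odd n n%56∈
  in construct h n≡4k (trans (cong (λ m → 7 * m / 4) n≡4k) (7*4k/4≡7k (suc (2 * h))))
  where
  -- With n and λ₁ as variables both equations can be matched with `refl`, and the parameters become
  -- literally those of `design`, with no transport of the design.
  construct : ∀ h {n λ₁} → n ≡ 4 * suc (2 * h) → λ₁ ≡ 7 * suc (2 * h) →
              ∃ λ (D : GDD n 2 6 λ₁ (2 * (n ∸ 1))) → HasConfiguration 2 4 D
  construct h refl refl = design , blocks-split
    where open Design h using (design; blocks-split)
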